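{- Let $G$ be a 2-connected graph with $n \geq 3$ vertices. Then for every vertex $u \in V(G)$, $$\Omega_G(u) \leq \frac{n^2-1}{6}.$$ Moreover, this bound is achieved (for a vertex $u$) if and only if $G = C_n$, the cycle on $n$ vertices.
   Context: All graphs are finite, simple and undirected. For a connected graph $G$ and vertices $i,j$, the resistance distance $\Omega_G(i,j)$ is the effective resistance between $i$ and $j$ in the electrical network obtained from $G$ by replacing each edge with a unit resistor. For $u\in V(G)$, the resistive eccentricity index is $\Omega_G(u)=\sum_{v\in V(G)}\Omega_G(u,v)$. A graph is 2-connected if it is connected, has at least three vertices, and has no cut vertex. -}

module Defs where

open import Data.Nat as ℕ using (ℕ; zero; suc; _∸_)
open import Data.Integer using (+_)
open import Data.Fin using (Fin; toℕ)
import Data.Bool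
open import Data.Fin.Properties using () renaming (_≟_ to _≟ᶠ_)
open import Data.Bool using (Bool; true; false; if_then_else_; _∨_)
open import Data.Rational using (ℚ; 0ℚ; 1ℚ; _+_; _-_; _*_; _/_)
open import Data.Product using (Σ; _×_; ∃)
open import Data.Unit using (⊤)
open import Relation.Nullary using (¬_; does)
open import Relation.Binary.PropositionalEquality using (_≡_; _≢_)
open import Function.Bundles using (_↔_; Inverse)

record Graph (n : ℕ) : Set where
  field
    adj     : Fin n → Fin n → Bool
    adj-sym : ∀ i j → adj i j ≡ adj j i
    irrefl  : ∀ i → adj i i ≡ false
open Graph public

Σℚ : ∀ {n} → (Fin n → ℚ) → ℚ
Σℚ {zero}  f = 0ℚ
Σℚ {suc n} f = f Fin.zero + Σℚ (λ i → f (Fin.suc i))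

⟦_⟧ : Bool → ℚ
⟦ true ⟧  = 1ℚ
⟦ false ⟧ = 0ℚ

δ : ∀ {n} → Fin n → Fin n → ℚ
δ i j = ⟦ does (i ≟ᶠ j) ⟧

laplacian : ∀ {n} → Graph n → (Fin n → ℚ) → Fin n → ℚ
laplacian G x i = Σℚ (λ j → ⟦ adj G i j ⟧ * (x i - x j))

-- Resistance distance (Kirchhoff): inject a unit current at u and extract it at v
-- in the unit-resistor network G; x is a node-potential vector satisfying
-- Kirchhoff's laws (L x = e_u - e_v), and the effective resistance is x_u - x_v.
-- For connected G such x exists and x_u - x_v is uniquely determined.
IsResistance : ∀ {n} → Graph n → Fin n → Fin n → ℚ → Set
IsResistance G u v r =
  Σ (Fin _ → ℚ) λ x →
    (∀ i → laplacian G x i ≡ δ i u - δ i v) × (r ≡ x u - x v)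

IsResistiveEccentricity : ∀ {n} → Graph n → Fin n → ℚ → Set
IsResistiveEccentricity {n} G u e =
  Σ (Fin n → ℚ) λ r → (∀ v → IsResistance G u v (r v)) × (e ≡ Σℚ r)

data Reach {n} (G : Graph n) (P : Fin n → Set) : Fin n → Fin n → Set where
  here : ∀ {a} → P a → Reach G P a a
  step : ∀ {a b c} → P a → adj G a b ≡ true → Reach G P b c → Reach G P a c

Connected : ∀ {n} → Graph n → Set
Connected G = ∀ a b → Reach G (λ _ → ⊤) a b

TwoConnected : ∀ {n} → Graph n → Set
TwoConnected {n} G =
  Connected G × (3 ℕ.≤ n) ×
  (∀ w a b → a ≢ w → b ≢ w → Reach G (λ x → x ≢ w) a b)

-- adjacency of the cycle C_n on 0,1,...,n-1 (i ~ i+1 and n-1 ~ 0); for n ≥ 3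
cycleAdj : (n : ℕ) → Fin n → Fin n → Bool
cycleAdj n i j =
  does (toℕ j ℕ.≟ suc (toℕ i)) ∨ does (toℕ i ℕ.≟ suc (toℕ j)) ∨
  (does (toℕ i ℕ.≟ 0) Data.Bool.∧ does (toℕ j ℕ.≟ n ∸ 1)) ∨
  (does (toℕ j ℕ.≟ 0) Data.Bool.∧ does (toℕ i ℕ.≟ n ∸ 1))

IsoToCycle : ∀ {n} → Graph n → Set
IsoToCycle {n} G =
  Σ (Fin n ↔ Fin n) λ σ →
    ∀ i j → adj G i j ≡ cycleAdj n (Inverse.to σ i) (Inverse.to σ j)

bound : ℕ → ℚ
bound n = (+ (n ℕ.* n ∸ 1)) / 6

{-# OPTIONS --safe #-}
-- Fix a neighbour t of u and an st-numbering of G from u to t, obtained by inserting ears into a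
-- list: every vertex other than u has an earlier neighbour, every vertex other than t a later one.
-- From the vertex v in position k, descending gives a path to u with at most k edges, while
-- ascending to t and taking the edge tu gives a disjoint path with at most n - k edges. A unit
-- current has energy equal to the resistance R of the pair u, v, so R ≥ R²/k + R²/(n - k), that is
-- R ≤ k (n - k) / n; summing over k gives (n² - 1) / 6. If some earlier neighbour of v, along an edge
-- other than tu, is not its immediate predecessor, then the descending path can be chosen
-- shorter and the inequality is strict, so in the case of equality G is the cycle.
module Submission where

open import Defs
import Algebra.Properties.CommutativeMonoid.Sum as CommutativeMonoidSum
import Algebra.Properties.Semiring.Sum as SemiringSum
open import Algebra.Bundles using (module CommutativeRing)
open import Data.Bool using (Bool; true; false; _∨_; _∧_)
open import Data.Bool.Properties using (∧-identityʳ; ∧-zeroʳ)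
open import Data.Empty using (⊥; ⊥-elim)
open import Data.Fin using (Fin; zero; suc; toℕ; cast)
open import Data.Fin.Permutation using (Permutation; _⟨$⟩ʳ_)
import Data.Fin.Properties as Fin
import Data.Integer as ℤ
import Data.Integer.Properties as ℤ
open import Data.List using (List; []; _∷_; [_]; _++_; _ʳ++_; reverse; length; allFin; lookup; tabulate)
open import Data.List.Membership.Propositional using (_∈_; _∉_)
open import Data.List.Membership.Propositional.Properties using (∈-++⁺ˡ; ∈-++⁺ʳ; ∈-++⁻; ∈-allFin; ∈-∃++; ∈-insert; ∈-lookup)
import Data.List.Membership.DecPropositional as DecMembership
open import Data.List.Properties using (++-assoc; ++-identityʳ; ++-ʳ++; ʳ++-ʳ++; ʳ++-defn; length-++; length-reverse; length-tabulate)
open import Data.List.Relation.Binary.Permutation.Propositional as Perm using (_↭_; ↭-sym; ↭-trans; ↭-prep; ↭⇒↭ₛ; module PermutationReasoning)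
open import Data.List.Relation.Binary.Permutation.Propositional.Properties using (∈-resp-↭; shift; shifts; ↭-reverse; ↭-length; ++⁺ˡ; ++⁺ʳ; ++-comm) renaming (++-assoc to ++-assoc-↭)
import Data.List.Relation.Binary.Permutation.Setoid.Properties as Permutationₛ
import Data.List.Relation.Unary.All as All
open import Data.List.Relation.Unary.AllPairs using (_∷_)
open import Data.List.Relation.Unary.Any using (here; there; index)
open import Data.List.Relation.Unary.Any.Properties using (lookup-index)
open import Data.List.Relation.Unary.Unique.Propositional using (Unique)
open import Data.List.Relation.Unary.Unique.Propositional.Properties using (Unique[x∷xs]⇒x∉xs; allFin⁺)
open import Data.Nat as ℕ using (ℕ; zero; suc; s≤s; z≤n; _≡ᵇ_; _⊓_)
import Data.Nat.Properties as ℕ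
open import Data.Product using (∃; ∃₂; _×_; _,_; proj₁; proj₂)
open import Data.Rational hiding (truncate; _⊓_)
open import Data.Rational.Properties
open import Data.Rational.Solver using (module +-*-Solver)
import Data.Rational.Unnormalised as ℚᵘ
import Data.Rational.Unnormalised.Properties as ℚᵘ
open import Data.Sum using (_⊎_; inj₁; inj₂)
open import Function.Base using (case_of_)
open import Function.Bundles using (_↔_; _⇔_; mk⇔; mk↔ₛ′; Inverse; Injection)
open import Function.Properties.Inverse using (↔⇒↣; ↔-sym)
open import Relation.Binary.Definitions using (tri<; tri≈; tri>)
open import Relation.Binary.PropositionalEquality hiding ([_])
open import Relation.Nullary using (yes; no; Dec; does)
open import Relation.Nullary.Decidable using (_⊎-dec_; _×-dec_; dec-true; dec-false)

open +-*-Solver using (solve; _:=_; _:+_; _:*_; _:-_; con)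

-- No path is built as an object. The vertices before v and those after v form complementary blocks
-- of the numbering, and the energy is a sum over unordered pairs of list entries, so pairs inside
-- different blocks are disjoint automatically. Only two edges leave the blocks: the first edge vw
-- of the descending path and the closing edge tu. They can coincide only when v = t and w = u, and
-- then 2-connectedness supplies another neighbour of t. Each term R²/k is the Cauchy-Schwarz
-- inequality for the potential drop along k unit edges, accumulated one edge at a time. Path
-- lengths enter only through block sizes: at most the position of v on one side, at most the number
-- of later vertices plus one for tu on the other. These sum to n, which is why t is chosen adjacent
-- to u.

private
  module Sum = CommutativeMonoidSum +-0-commutativeMonoid

-- Rational arithmetic

p≤q⇒0≤q-p : ∀ {p q} → p ≤ q → 0ℚ ≤ q - p
p≤q⇒0≤q-p {p} {q} p≤q = subst (_≤ q - p) (+-inverseʳ p) (+-monoˡ-≤ (- p) p≤q)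

0≤q-p⇒p≤q : ∀ {p q} → 0ℚ ≤ q - p → p ≤ q
0≤q-p⇒p≤q {p} {q} 0≤q-p = subst₂ _≤_ (+-identityʳ p)
  (solve 2 (λ p q → p :+ (q :- p) := q) refl p q) (+-monoʳ-≤ p 0≤q-p)

0<q-p⇒p<q : ∀ {p q} → 0ℚ < q - p → p < q
0<q-p⇒p<q {p} {q} 0<q-p = subst₂ _<_ (+-identityʳ p)
  (solve 2 (λ p q → p :+ (q :- p) := q) refl p q) (+-monoʳ-< p 0<q-p)

0≤p+q : ∀ {p q} → 0ℚ ≤ p → 0ℚ ≤ q → 0ℚ ≤ p + q
0≤p+q 0≤p 0≤q = +-mono-≤ 0≤p 0≤q

*-mono-≤ˡ : ∀ {c p q} → 0ℚ ≤ c → p ≤ q → c * p ≤ c * q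
*-mono-≤ˡ {c} 0≤c = *-monoˡ-≤-nonNeg c where instance _ = nonNegative 0≤c

*-cancel-≤ˡ : ∀ {c p q} → 0ℚ < c → c * p ≤ c * q → p ≤ q
*-cancel-≤ˡ {c} 0<c = *-cancelˡ-≤-pos c where instance _ = positive 0<c

*-cancel-<ˡ : ∀ {c p q} → 0ℚ ≤ c → c * p < c * q → p < q
*-cancel-<ˡ {c} 0≤c = *-cancelˡ-<-nonNeg c where instance _ = nonNegative 0≤c

0≤p*q : ∀ {p q} → 0ℚ ≤ p → 0ℚ ≤ q → 0ℚ ≤ p * q
0≤p*q {p} {q} 0≤p 0≤q = subst (_≤ p * q) (*-zeroʳ p) (*-mono-≤ˡ 0≤p 0≤q)

0<p*q : ∀ {p q} → 0ℚ < p → 0ℚ < q → 0ℚ < p * q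
0<p*q {p} {q} 0<p 0<q = subst (_< p * q) (*-zeroʳ p) (*-monoʳ-<-pos p 0<q)
  where instance _ = positive 0<p

0≤p*p : ∀ p → 0ℚ ≤ p * p
0≤p*p p with ≤-total 0ℚ p
... | inj₁ 0≤p = 0≤p*q 0≤p 0≤p
... | inj₂ p≤0 = subst (0ℚ ≤_) (solve 1 (λ p → (con 0ℚ :- p) :* (con 0ℚ :- p) := p :* p) refl p)
  (0≤p*q (p≤q⇒0≤q-p p≤0) (p≤q⇒0≤q-p p≤0))

p*p≤0⇒p≡0 : ∀ {p} → p * p ≤ 0ℚ → p ≡ 0ℚ
p*p≤0⇒p≡0 {p} p²≤0 with <-cmp p 0ℚ
... | tri≈ _ p≡0 _ = p≡0
... | tri> _ _ 0<p = ⊥-elim (<-irrefl refl (<-≤-trans (0<p*q 0<p 0<p) p²≤0))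
... | tri< p<0 _ _ = ⊥-elim (<-irrefl refl (<-≤-trans 0<p² p²≤0))
  where
  0<-p : 0ℚ < - p
  0<-p = neg-antimono-< p<0
  0<p² : 0ℚ < p * p
  0<p² = subst (0ℚ <_) (solve 1 (λ p → (+-*-Solver.:- p) :* (+-*-Solver.:- p) := p :* p) refl p) (0<p*q 0<-p 0<-p)

fromℕ : ℕ → ℚ
fromℕ zero    = 0ℚ
fromℕ (suc n) = 1ℚ + fromℕ n

fromℕ-+ : ∀ m n → fromℕ (m ℕ.+ n) ≡ fromℕ m + fromℕ n
fromℕ-+ zero    n = sym (+-identityˡ _)
fromℕ-+ (suc m) n = trans (cong (1ℚ +_) (fromℕ-+ m n)) (sym (+-assoc 1ℚ (fromℕ m) (fromℕ n)))

fromℕ-* : ∀ m n → fromℕ (m ℕ.* n) ≡ fromℕ m * fromℕ n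
fromℕ-* zero    n = sym (*-zeroˡ (fromℕ n))
fromℕ-* (suc m) n = begin
  fromℕ (n ℕ.+ m ℕ.* n)      ≡⟨ fromℕ-+ n (m ℕ.* n) ⟩
  fromℕ n + fromℕ (m ℕ.* n)  ≡⟨ cong (fromℕ n +_) (fromℕ-* m n) ⟩
  fromℕ n + fromℕ m * fromℕ n
    ≡⟨ solve 2 (λ a b → b :+ a :* b := (con 1ℚ :+ a) :* b) refl (fromℕ m) (fromℕ n) ⟩
  fromℕ (suc m) * fromℕ n    ∎
  where open ≡-Reasoning

0≤fromℕ : ∀ n → 0ℚ ≤ fromℕ n
0≤fromℕ zero    = ≤-refl
0≤fromℕ (suc n) = 0≤p+q (nonNegative⁻¹ 1ℚ) (0≤fromℕ n)

0<fromℕ : ∀ n → 0ℚ < fromℕ (suc n)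
0<fromℕ n = +-mono-<-≤ (positive⁻¹ 1ℚ) (0≤fromℕ n)

fromℕ≡/1 : ∀ n → fromℕ n ≡ ℤ.+ n / 1
fromℕ≡/1 zero    = refl
fromℕ≡/1 (suc n) = trans (cong (1ℚ +_) (fromℕ≡/1 n)) (toℚᵘ-injective (begin
  toℚᵘ (1ℚ + ℤ.+ n / 1)             ≈⟨ toℚᵘ-homo-+ 1ℚ (ℤ.+ n / 1) ⟩
  toℚᵘ 1ℚ ℚᵘ.+ toℚᵘ (ℤ.+ n / 1)     ≈⟨ ℚᵘ.+-congʳ (toℚᵘ 1ℚ) (toℚᵘ-fromℚᵘ (ℤ.+ n ℚᵘ./ 1)) ⟩
  ℚᵘ.1ℚᵘ ℚᵘ.+ (ℤ.+ n ℚᵘ./ 1)        ≈⟨ ℚᵘ.*≡* (cong (λ k → (ℤ.+ 1 ℤ.+ k) ℤ.* ℤ.+ 1) (ℤ.*-identityʳ (ℤ.+ n))) ⟩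
  ℤ.+ suc n ℚᵘ./ 1                  ≈⟨ toℚᵘ-fromℚᵘ (ℤ.+ suc n ℚᵘ./ 1) ⟨
  toℚᵘ (ℤ.+ suc n / 1)              ∎))
  where open ℚᵘ.≃-Reasoning

6*/6 : ∀ n → fromℕ 6 * (ℤ.+ n / 6) ≡ fromℕ n
6*/6 n = trans (toℚᵘ-injective (begin
  toℚᵘ (fromℕ 6 * (ℤ.+ n / 6))             ≈⟨ toℚᵘ-homo-* (fromℕ 6) (ℤ.+ n / 6) ⟩
  toℚᵘ (fromℕ 6) ℚᵘ.* toℚᵘ (ℤ.+ n / 6)     ≈⟨ ℚᵘ.*-congˡ {toℚᵘ (fromℕ 6)} (toℚᵘ-fromℚᵘ (ℤ.+ n ℚᵘ./ 6)) ⟩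
  (ℤ.+ 6 ℚᵘ./ 1) ℚᵘ.* (ℤ.+ n ℚᵘ./ 6)         ≈⟨ ℚᵘ.*≡* (trans (ℤ.*-identityʳ (ℤ.+ 6 ℤ.* ℤ.+ n)) (ℤ.*-comm (ℤ.+ 6) (ℤ.+ n))) ⟩
  ℤ.+ n ℚᵘ./ 1                             ≈⟨ toℚᵘ-fromℚᵘ (ℤ.+ n ℚᵘ./ 1) ⟨
  toℚᵘ (ℤ.+ n / 1)                         ∎)) (sym (fromℕ≡/1 n))
  where open ℚᵘ.≃-Reasoning

6*bound : ∀ m → fromℕ 6 * bound (suc m) ≡ fromℕ (suc m) * fromℕ (suc m) - 1ℚ
6*bound m = begin
  fromℕ 6 * bound (suc m)                  ≡⟨ 6*/6 (m ℕ.+ m ℕ.* suc m) ⟩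
  fromℕ (m ℕ.+ m ℕ.* suc m)                ≡⟨ fromℕ-+ m (m ℕ.* suc m) ⟩
  fromℕ m + fromℕ (m ℕ.* suc m)            ≡⟨ cong (fromℕ m +_) (fromℕ-* m (suc m)) ⟩
  fromℕ m + fromℕ m * (1ℚ + fromℕ m)
    ≡⟨ solve 1 (λ a → a :+ a :* (con 1ℚ :+ a) := (con 1ℚ :+ a) :* (con 1ℚ :+ a) :- con 1ℚ) refl (fromℕ m) ⟩
  fromℕ (suc m) * fromℕ (suc m) - 1ℚ       ∎
  where open ≡-Reasoning

-- Multiplied by m, the difference of the two sides is at least (a - m b)².
series-≤ : ∀ m {a b e f} → a * a ≤ fromℕ m * e → b * b ≤ f → 0ℚ ≤ e →
  (a + b) * (a + b) ≤ fromℕ (suc m) * (e + f)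
series-≤ zero {a} {b} {e} {f} a²≤ b²≤f 0≤e = begin
  (a + b) * (a + b)     ≡⟨ cong (λ a → (a + b) * (a + b)) (p*p≤0⇒p≡0 {a} (≤-trans a²≤ (≤-reflexive (*-zeroˡ e)))) ⟩
  (0ℚ + b) * (0ℚ + b)   ≡⟨ cong (λ b → b * b) (+-identityˡ b) ⟩
  b * b                 ≤⟨ b²≤f ⟩
  f                     ≡⟨ +-identityˡ f ⟨
  0ℚ + f                ≤⟨ +-monoˡ-≤ f 0≤e ⟩
  e + f                 ≡⟨ *-identityˡ (e + f) ⟨
  1ℚ * (e + f)          ∎
  where open ≤-Reasoning
series-≤ (suc m) {a} {b} {e} {f} a²≤ b²≤f 0≤e = *-cancel-≤ˡ {M} (0<fromℕ m) (0≤q-p⇒p≤q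
  (subst (0ℚ ≤_)
    (solve 5 (λ M a b e f →
        (con 1ℚ :+ M) :* (M :* e :- a :* a) :+ (M :* (con 1ℚ :+ M)) :* (f :- b :* b)
          :+ (a :- M :* b) :* (a :- M :* b)
        := M :* ((con 1ℚ :+ M) :* (e :+ f)) :- M :* ((a :+ b) :* (a :+ b)))
      refl M a b e f)
    (0≤p+q (0≤p+q (0≤p*q (0≤fromℕ (suc (suc m))) (p≤q⇒0≤q-p a²≤))
                  (0≤p*q (0≤p*q (0≤fromℕ (suc m)) (0≤fromℕ (suc (suc m)))) (p≤q⇒0≤q-p b²≤f)))
           (0≤p*p (a - M * b)))))
  where M = fromℕ (suc m)

-- Multiplied by `R`, the difference of the two sides is the sum of the slacks of the last three
-- hypotheses with weights `l`, `k` and `k * l`. Dividing by `R` again requires it to be positive,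
-- hence the separate case `R ≡ 0ℚ`.
parallel-≤ : ∀ {k l R α β} → 0ℚ ≤ k → 0ℚ ≤ l → 0ℚ ≤ R →
  R * R ≤ k * α → R * R ≤ l * β → α + β ≤ R → (k + l) * R ≤ k * l
parallel-≤ {k} {l} {R} {α} {β} 0≤k 0≤l 0≤R R²≤kα R²≤lβ α+β≤R with R ≟ 0ℚ
... | yes refl = ≤-trans (≤-reflexive (*-zeroʳ (k + l))) (0≤p*q 0≤k 0≤l)
... | no R≢0 = *-cancel-≤ˡ 0<R (0≤q-p⇒p≤q (subst (0ℚ ≤_)
  (solve 5 (λ k l R α β →
      l :* (k :* α :- R :* R) :+ k :* (l :* β :- R :* R) :+ (k :* l) :* (R :- (α :+ β))
      := R :* (k :* l) :- R :* ((k :+ l) :* R)) refl k l R α β)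
  (0≤p+q (0≤p+q (0≤p*q 0≤l (p≤q⇒0≤q-p R²≤kα)) (0≤p*q 0≤k (p≤q⇒0≤q-p R²≤lβ)))
         (0≤p*q (0≤p*q 0≤k 0≤l) (p≤q⇒0≤q-p α+β≤R)))))
  where
  0<R : 0ℚ < R
  0<R with <-cmp 0ℚ R
  ... | tri< 0<R _ _ = 0<R
  ... | tri≈ _ 0≡R _ = ⊥-elim (R≢0 (sym 0≡R))
  ... | tri> _ _ R<0 = ⊥-elim (<-irrefl refl (<-≤-trans R<0 0≤R))

module _ {k l R : ℚ} (0≤k : 0ℚ ≤ k) (0<l : 0ℚ < l) (h : (k + l) * R ≤ k * l) where

  private
    R<l : R < l
    R<l = *-cancel-<ˡ (0≤p+q 0≤k (<⇒≤ 0<l)) (≤-<-trans h (0<q-p⇒p<q (subst (0ℚ <_)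
      (solve 2 (λ k l → l :* l := (k :+ l) :* l :- k :* l) refl k l) (0<p*q 0<l 0<l))))

    -- Lengthening the first path from `k` to `d + k` increases the slack by exactly `d * (l - R)`,
    -- and `R<l` makes this positive for positive `d`. A bound obtained from a shortcut thus passes
    -- to the full length.
    slack : ∀ d → (k * l - (k + l) * R) + d * (l - R) ≡ (d + k) * l - (d + k + l) * R
    slack d = solve 4 (λ k l R d → (k :* l :- (k :+ l) :* R) :+ d :* (l :- R)
      := (d :+ k) :* l :- (d :+ k :+ l) :* R) refl k l R d

  parallel-weaken-≤ : ∀ {d} → 0ℚ ≤ d → (d + k + l) * R ≤ (d + k) * l
  parallel-weaken-≤ {d} 0≤d = 0≤q-p⇒p≤q (subst (0ℚ ≤_) (slack d)
    (0≤p+q (p≤q⇒0≤q-p h) (0≤p*q 0≤d (p≤q⇒0≤q-p (<⇒≤ R<l)))))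

  parallel-weaken-< : ∀ {d} → 0ℚ < d → (d + k + l) * R < (d + k) * l
  parallel-weaken-< {d} 0<d = 0<q-p⇒p<q (subst (0ℚ <_) (slack d)
    (+-mono-≤-< (p≤q⇒0≤q-p h) (0<p*q 0<d 0<l-R)))
    where
    0<l-R : 0ℚ < l - R
    0<l-R = subst (_< l - R) (+-inverseʳ R) (+-monoˡ-< (- R) R<l)

-- st-numberings

Unique-resp-↭ : ∀ {A : Set} {xs ys : List A} → xs ↭ ys → Unique xs → Unique ys
Unique-resp-↭ {A} p = Permutationₛ.Unique-resp-↭ (setoid A) (↭⇒↭ₛ p)

∈⇒↭ : ∀ {A : Set} {x : A} {xs} → x ∈ xs → ∃ λ ys → xs ↭ x ∷ ys
∈⇒↭ x∈xs with ∈-∃++ x∈xs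
... | ys , zs , refl = ys ++ zs , shift _ ys zs

∈-separate : ∀ {A : Set} {a b : A} {xs} → a ≢ b → a ∈ xs → b ∈ xs →
  ∃₂ λ ys zs → xs ≡ ys ++ zs × (a ∈ ys × b ∈ zs ⊎ b ∈ ys × a ∈ zs)
∈-separate a≢b (here refl) (here refl) = ⊥-elim (a≢b refl)
∈-separate a≢b (here refl) (there b∈)  = [ _ ] , _ , refl , inj₁ (here refl , b∈)
∈-separate a≢b (there a∈)  (here refl) = [ _ ] , _ , refl , inj₂ (here refl , a∈)
∈-separate a≢b (there a∈)  (there b∈) with ∈-separate a≢b a∈ b∈
... | ys , zs , refl , inj₁ (a∈ys , b∈zs) = _ ∷ ys , zs , refl , inj₁ (there a∈ys , b∈zs)
... | ys , zs , refl , inj₂ (b∈ys , a∈zs) = _ ∷ ys , zs , refl , inj₂ (there b∈ys , a∈zs)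

∈-reverse⁺ : ∀ {A : Set} {x : A} {xs} → x ∈ xs → x ∈ reverse xs
∈-reverse⁺ {xs = xs} = ∈-resp-↭ (↭-sym (↭-reverse xs))

reverse-ʳ++ : ∀ {A : Set} (xs : List A) {ys} → reverse xs ʳ++ ys ≡ xs ++ ys
reverse-ʳ++ xs = ʳ++-ʳ++ xs

module Numbering {n : ℕ} (G : Graph n) where

  open DecMembership (Fin._≟_ {n}) using (_∈?_)

  infix 4 _~_
  _~_ : Fin n → Fin n → Set
  a ~ b = adj G a b ≡ true

  ~-sym : ∀ {a b} → a ~ b → b ~ a
  ~-sym {a} {b} a~b = trans (adj-sym G b a) a~b

  -- A rooted tree listed with children before parents: every entry except the final `r` has a
  -- neighbour further along the list. Nothing prescribes which one, so the list order alone bounds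
  -- the depth.
  data Tree (r : Fin n) : List (Fin n) → Set where
    root : Tree r [ r ]
    node : ∀ {v w S} → w ∈ S → v ~ w → Tree r S → Tree r (v ∷ S)

  tree-root∈ : ∀ {r S} → Tree r S → r ∈ S
  tree-root∈ root         = here refl
  tree-root∈ (node _ _ τ) = there (tree-root∈ τ)

  tree-suffix : ∀ {r} A {a S} → a ∈ S → Tree r (A ++ S) → Tree r S
  tree-suffix []          _  τ            = τ
  tree-suffix (_ ∷ [])    () root
  tree-suffix (_ ∷ A)     a∈ (node _ _ τ) = tree-suffix A a∈ τ

  tree-suffixʳ : ∀ {r} A {a S} → a ∈ S → Tree r (A ʳ++ S) → Tree r S
  tree-suffixʳ {r} A {S = S} a∈ τ = tree-suffix (reverse A) a∈ (subst (Tree r) (ʳ++-defn A) τ)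

  -- Entries of `A` keep their parents, which lie in `A` or `B` and still come later once `P` is
  -- inserted; the rest is the second tree.
  tree-insert : ∀ {r} A P {b B} → b ∈ B → Tree r (A ++ B) → Tree r (P ++ B) → Tree r (A ++ P ++ B)
  tree-insert []      P _  _             τ′ = τ′
  tree-insert (_ ∷ []) P () root         τ′
  tree-insert (_ ∷ A) P {B = B} b∈ (node w∈ v~w τ) τ′ = node (mono (∈-++⁻ A w∈)) v~w (tree-insert A P b∈ τ τ′)
    where
    mono : ∀ {w} → w ∈ A ⊎ w ∈ B → w ∈ A ++ P ++ B
    mono (inj₁ w∈A) = ∈-++⁺ˡ w∈A
    mono (inj₂ w∈B) = ∈-++⁺ʳ A (∈-++⁺ʳ P w∈B)

  -- Only the interior of the ear: a simple path outside `M` whose last vertex is adjacent to `b`.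
  -- The fact `b ∈ M` and the edge from the other endpoint to the first vertex are carried
  -- separately.
  data Ear (M : List (Fin n)) (b : Fin n) : List (Fin n) → Set where
    last : ∀ {x} → x ∉ M → x ~ b → Ear M b [ x ]
    cons : ∀ {x y P} → x ∉ M → x ∉ y ∷ P → x ~ y → Ear M b (y ∷ P) → Ear M b (x ∷ y ∷ P)

  ear-suffix : ∀ {M b x P} → x ∈ P → Ear M b P → ∃ λ Q → Ear M b (x ∷ Q)
  ear-suffix (here refl) ε              = _ , ε
  ear-suffix (there x∈)  (cons _ _ _ ε) = ear-suffix x∈ ε

  reach-start : ∀ {P a b} → Reach G P a b → P a
  reach-start (here pa)     = pa
  reach-start (step pa _ _) = pa

  -- Loop erasure of a walk that leaves x ∉ M, stopped on first hitting M.
  erase-loops : ∀ {M a x c} → Reach G (_≢ a) x c → x ∉ M → c ∈ M →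
    ∃₂ λ b P → b ∈ M × b ≢ a × Ear M b (x ∷ P)
  erase-loops (here _) x∉ c∈ = ⊥-elim (x∉ c∈)
  erase-loops {M} (step {b = y} _ x~y ρ) x∉ c∈ with y ∈? M
  ... | yes y∈ = y , [] , y∈ , reach-start ρ , last x∉ x~y
  ... | no  y∉ with erase-loops ρ y∉ c∈
  ...   | b , P , b∈ , b≢a , ε with _ ∈? y ∷ P
  ...     | yes x∈ = b , _ , b∈ , b≢a , proj₂ (ear-suffix x∈ ε)
  ...     | no x∉P = b , _ , b∈ , b≢a , cons x∉ x∉P x~y ε

  ear-tree-++ : ∀ {M b P r S} → Ear M b P → b ∈ S → Tree r S → Tree r (P ++ S)
  ear-tree-++ (last _ x~b)     b∈ τ = node b∈ x~b τ
  ear-tree-++ (cons _ _ x~y ε) b∈ τ = node (here refl) x~y (ear-tree-++ ε b∈ τ)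

  -- Read backwards, each ear vertex has its predecessor on the ear as parent, and `x` has `a`; in
  -- `ear-tree-++` the parent is the successor. The two together give an inserted ear vertex both an
  -- earlier and a later neighbour.
  ear-tree-ʳ++ : ∀ {M a b x P r S} → Ear M b (x ∷ P) → a ~ x → a ∈ S → Tree r S → Tree r ((x ∷ P) ʳ++ S)
  ear-tree-ʳ++ (last _ _)       a~x a∈ τ = node a∈ (~-sym a~x) τ
  ear-tree-ʳ++ (cons _ _ x~y ε) a~x a∈ τ = ear-tree-ʳ++ ε x~y (here refl) (node a∈ (~-sym a~x) τ)

  -- An ear avoids `M` and has no repetitions, so its vertices can be taken out of the unplaced list
  -- `O` one by one. This is what makes the number of unplaced vertices decrease.
  ear-extract : ∀ {M b P O} → (∀ x → x ∈ M ++ O) → Ear M b P → ∃ λ O′ → O ↭ P ++ O′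
  ear-extract {M} all (last {x} x∉ _) with ∈-++⁻ M (all x)
  ... | inj₁ x∈ = ⊥-elim (x∉ x∈)
  ... | inj₂ x∈ = ∈⇒↭ x∈
  ear-extract {M} {O = O} all (cons {x} {y} {P} x∉ x∉P _ ε) with ∈-++⁻ M (all x) | ear-extract all ε
  ... | inj₁ x∈ | _ = ⊥-elim (x∉ x∈)
  ... | inj₂ x∈ | O′ , O↭ with ∈-++⁻ (y ∷ P) (∈-resp-↭ O↭ x∈)
  ...   | inj₁ x∈P  = ⊥-elim (x∉P x∈P)
  ...   | inj₂ x∈O′ with ∈⇒↭ x∈O′
  ...     | O″ , O′↭ = O″ , ↭-trans O↭ (↭-trans (++⁺ˡ (y ∷ P) O′↭) (shift x (y ∷ P) O″))

  exit : ∀ {Q a o} M → Reach G Q a o → a ∈ M → o ∉ M → ∃₂ λ a′ x → a′ ∈ M × x ∉ M × a′ ~ x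
  exit M (here _) a∈ o∉ = ⊥-elim (o∉ a∈)
  exit M (step {a} {b} _ a~b ρ) a∈ o∉ with b ∈? M
  ... | yes b∈ = exit M ρ b∈ o∉
  ... | no  b∉ = a , b , a∈ , b∉ , a~b

  Bipolar : Fin n → Fin n → List (Fin n) → Set
  Bipolar u t M = Tree t M × Tree u (reverse M)

  -- Parents in the first tree lie to the right and in the second to the left, so it suffices that
  -- `P` can be put in front of `B` for the one (`f`) and of `reverse A` for the other (`g`).
  bipolar-insert : ∀ {u t} A P B {a b} → a ∈ A → b ∈ B → Bipolar u t (A ++ B) →
    (Tree t B → Tree t (P ++ B)) → (Tree u (reverse A) → Tree u (P ʳ++ reverse A)) →
    Bipolar u t (A ++ P ++ B)
  bipolar-insert {u} {t} A P B a∈ b∈ (τ , τ′) f g =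
    tree-insert A P b∈ τ (f (tree-suffix A b∈ τ)) ,
    subst (Tree u) (sym eq₂) (tree-insert (reverse B) (reverse P) (∈-reverse⁺ a∈) τ″
      (subst (Tree u) (ʳ++-defn P) (g (tree-suffix (reverse B) (∈-reverse⁺ a∈) τ″))))
    where
    eq₁ : reverse (A ++ B) ≡ reverse B ++ reverse A
    eq₁ = trans (++-ʳ++ A) (ʳ++-defn B)
    eq₂ : reverse (A ++ P ++ B) ≡ reverse B ++ reverse P ++ reverse A
    eq₂ = trans (++-ʳ++ A) (trans (++-ʳ++ P) (trans (ʳ++-defn B) (cong (reverse B ++_) (ʳ++-defn P))))
    τ″ = subst (Tree u) eq₁ τ′

  -- For the opposite order of a and b, the same ear is inserted backwards.
  bipolar-add-ear : ∀ {u t M a b x P} → Bipolar u t M → a ≢ b → a ∈ M → b ∈ M →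
    a ~ x → Ear M b (x ∷ P) → ∃ λ M′ → Bipolar u t M′ × M′ ↭ (x ∷ P) ++ M
  bipolar-add-ear {x = x} {P} β a≢b a∈ b∈ a~x ε with ∈-separate a≢b a∈ b∈
  ... | A , B , refl , inj₁ (a∈A , b∈B) = A ++ (x ∷ P) ++ B ,
        bipolar-insert A (x ∷ P) B a∈A b∈B β (ear-tree-++ ε b∈B) (ear-tree-ʳ++ ε a~x (∈-reverse⁺ a∈A)) ,
        shifts A (x ∷ P)
  ... | A , B , refl , inj₂ (b∈A , a∈B) = A ++ reverse (x ∷ P) ++ B ,
        bipolar-insert A (reverse (x ∷ P)) B b∈A a∈B β
          (λ τ → subst (Tree _) (ʳ++-defn (x ∷ P)) (ear-tree-ʳ++ ε a~x a∈B τ))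
          (λ τ → subst (Tree _) (sym (reverse-ʳ++ (x ∷ P))) (ear-tree-++ ε (∈-reverse⁺ b∈A) τ)) ,
        (begin
          A ++ reverse (x ∷ P) ++ B    ↭⟨ ++-assoc-↭ A (reverse (x ∷ P)) B ⟨
          (A ++ reverse (x ∷ P)) ++ B  ↭⟨ ++⁺ʳ B (++⁺ˡ A (↭-reverse (x ∷ P))) ⟩
          (A ++ x ∷ P) ++ B            ↭⟨ ++⁺ʳ B (++-comm A (x ∷ P)) ⟩
          ((x ∷ P) ++ A) ++ B          ↭⟨ ++-assoc-↭ (x ∷ P) A B ⟩
          (x ∷ P) ++ A ++ B            ∎)
    where open PermutationReasoning

  module _ (conn : Connected G) (2conn : ∀ w a b → a ≢ w → b ≢ w → Reach G (_≢ w) a b)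
           {u t : Fin n} (u≢t : u ≢ t) where

    -- An edge `a ~ x` leaves `M` because `o` is still unplaced. Of `u` and `t` one differs from
    -- `a`; a walk from `x` to it avoiding `a` first meets `M` at some `b` other than `a`. That
    -- gives an ear with distinct endpoints, which places at least `x`.
    bipolar-step : ∀ {M o O} → Bipolar u t M → M ++ o ∷ O ↭ allFin n →
      ∃₂ λ M′ O′ → Bipolar u t M′ × M′ ++ O′ ↭ allFin n × length O′ ℕ.≤ length O
    bipolar-step {M} {o} {O} β p =
      let o∉M = λ o∈ → Unique[x∷xs]⇒x∉xs (Unique-resp-↭ (↭-trans (↭-sym p) (shift o M O)) (allFin⁺ n)) (∈-++⁺ˡ o∈)
          t∈M = tree-root∈ (proj₁ β)
          u∈M = ∈-resp-↭ (↭-reverse M) (tree-root∈ (proj₂ β))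
          a , x , a∈ , x∉ , a~x = exit M (conn u o) u∈M o∉M
          c , c∈ , c≢a = other a t∈M u∈M
          b , P , b∈ , b≢a , ε = erase-loops (2conn a x c (λ x≡a → x∉ (subst (_∈ M) (sym x≡a) a∈)) c≢a) x∉ c∈
          M′ , β′ , M′↭ = bipolar-add-ear β (λ a≡b → b≢a (sym a≡b)) a∈ b∈ a~x ε
          O′ , O↭ = ear-extract (λ x → ∈-resp-↭ (↭-sym p) (∈-allFin x)) ε
      in M′ , O′ , β′ ,
         ↭-trans (↭-trans (++⁺ʳ O′ (↭-trans M′↭ (++-comm (x ∷ P) M))) (++-assoc-↭ M (x ∷ P) O′))
           (↭-trans (++⁺ˡ M (↭-sym O↭)) p) ,
         ℕ.≤-trans (ℕ.m≤n+m (length O′) (length P))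
           (ℕ.≤-reflexive (trans (sym (length-++ P)) (ℕ.suc-injective (sym (↭-length O↭)))))
      where
      other : ∀ a → t ∈ M → u ∈ M → ∃ λ c → c ∈ M × c ≢ a
      other a t∈M u∈M with u Fin.≟ a
      ... | yes refl = t , t∈M , λ t≡u → u≢t (sym t≡u)
      ... | no u≢a   = u , u∈M , u≢a

    -- The recursion is on a bound `k` for the number of unplaced vertices, because the list
    -- returned by `bipolar-step` is not structurally a part of `O`.
    bipolar-extend : ∀ k {M O} → length O ℕ.≤ k → Bipolar u t M → M ++ O ↭ allFin n →
      ∃ λ M′ → Bipolar u t M′ × M′ ↭ allFin n
    bipolar-extend k {M} {[]} _ β p = M , β , subst (_↭ allFin n) (++-identityʳ M) p
    bipolar-extend (suc k) {O = _ ∷ _} (s≤s h) β p with bipolar-step β p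
    ... | _ , _ , β′ , p′ , h′ = bipolar-extend k (ℕ.≤-trans h′ h) β′ p′

    bipolar-exists : u ~ t → ∃ λ M → Bipolar u t M × M ↭ allFin n
    bipolar-exists u~t =
      let O , p  = ∈⇒↭ (∈-allFin u)
          O′ , q = ∈⇒↭ (t∈ (∈-resp-↭ p (∈-allFin t)))
      in bipolar-extend (length O′) ℕ.≤-refl
           -- The initial numbering is the single edge, listed as `u ∷ t ∷ []`.
           (node (here refl) u~t root , node (here refl) (~-sym u~t) root)
           (↭-sym (↭-trans p (↭-prep u q)))
      where
      t∈ : ∀ {S} → t ∈ u ∷ S → t ∈ S
      t∈ (here t≡u) = ⊥-elim (u≢t (sym t≡u))
      t∈ (there h)  = h

-- Energy and resistance

Σℚ≡sum : ∀ {n} (f : Fin n → ℚ) → Σℚ f ≡ Sum.sum f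
Σℚ≡sum {zero}  f = refl
Σℚ≡sum {suc n} f = cong (f zero +_) (Σℚ≡sum (λ i → f (suc i)))

Σℚ-cong : ∀ {n} {f g : Fin n → ℚ} → (∀ i → f i ≡ g i) → Σℚ f ≡ Σℚ g
Σℚ-cong {zero}  h = refl
Σℚ-cong {suc n} h = cong₂ _+_ (h zero) (Σℚ-cong (λ i → h (suc i)))

Σℚ-+ : ∀ {n} (f g : Fin n → ℚ) → Σℚ (λ i → f i + g i) ≡ Σℚ f + Σℚ g
Σℚ-+ f g = trans (Σℚ≡sum (λ i → f i + g i)) (trans (Sum.∑-distrib-+ f g) (sym (cong₂ _+_ (Σℚ≡sum f) (Σℚ≡sum g))))

Σℚ-*ʳ : ∀ {n} (f : Fin n → ℚ) c → Σℚ (λ i → f i * c) ≡ Σℚ f * c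
Σℚ-*ʳ f c = trans (Σℚ≡sum (λ i → f i * c))
  (trans (sym (SemiringSum.*-distribʳ-sum (CommutativeRing.semiring +-*-commutativeRing) c f)) (cong (_* c) (sym (Σℚ≡sum f))))

Σℚ-comm : ∀ {m n} (f : Fin m → Fin n → ℚ) →
  Σℚ (λ i → Σℚ (f i)) ≡ Σℚ (λ j → Σℚ (λ i → f i j))
Σℚ-comm f = trans (double f) (trans (Sum.∑-comm f) (sym (double (λ j i → f i j))))
  where
  double : ∀ {m n} (f : Fin m → Fin n → ℚ) → Σℚ (λ i → Σℚ (f i)) ≡ Sum.sum (λ i → Sum.sum (f i))
  double f = trans (Σℚ-cong (λ i → Σℚ≡sum (f i))) (Σℚ≡sum (λ i → Sum.sum (f i)))

Σℚ-permute : ∀ {m n} (f : Fin n → ℚ) (π : Permutation m n) → Σℚ f ≡ Σℚ (λ i → f (π ⟨$⟩ʳ i))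
Σℚ-permute f π = trans (Σℚ≡sum f) (trans (Sum.sum-permute f π) (sym (Σℚ≡sum (λ i → f (π ⟨$⟩ʳ i)))))

Σℚ-mono-≤ : ∀ {n} {f g : Fin n → ℚ} → (∀ i → f i ≤ g i) → Σℚ f ≤ Σℚ g
Σℚ-mono-≤ {zero}  h = ≤-refl
Σℚ-mono-≤ {suc n} h = +-mono-≤ (h zero) (Σℚ-mono-≤ (λ i → h (suc i)))

Σℚ-mono-< : ∀ {n} {f g : Fin n → ℚ} i → (∀ i → f i ≤ g i) → f i < g i → Σℚ f < Σℚ g
Σℚ-mono-< zero    h fi<gi = +-mono-<-≤ fi<gi (Σℚ-mono-≤ (λ i → h (suc i)))
Σℚ-mono-< (suc i) h fi<gi = +-mono-≤-< (h zero) (Σℚ-mono-< i (λ i → h (suc i)) fi<gi)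

Σℚ-0 : ∀ n → Σℚ {n} (λ _ → 0ℚ) ≡ 0ℚ
Σℚ-0 zero    = refl
Σℚ-0 (suc n) = trans (+-identityˡ _) (Σℚ-0 n)

Σℚ-δ : ∀ {n} (u : Fin n) (f : Fin n → ℚ) → Σℚ (λ i → δ i u * f i) ≡ f u
Σℚ-δ {suc n} zero f = begin
  1ℚ * f zero + Σℚ (λ i → 0ℚ * f (suc i))
    ≡⟨ cong₂ _+_ (*-identityˡ (f zero)) (trans (Σℚ-cong (λ i → *-zeroˡ (f (suc i)))) (Σℚ-0 n)) ⟩
  f zero + 0ℚ  ≡⟨ +-identityʳ (f zero) ⟩
  f zero       ∎
  where open ≡-Reasoning
Σℚ-δ {suc n} (suc u) f = trans (cong₂ _+_ (*-zeroˡ (f zero)) (Σℚ-δ u (λ i → f (suc i)))) (+-identityˡ _)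

-- Sums over lists, and the energy of a list.

sumOver : ∀ {A : Set} → (A → ℚ) → List A → ℚ
sumOver f []       = 0ℚ
sumOver f (x ∷ xs) = f x + sumOver f xs

module _ {A : Set} where

  sumOver-cong : ∀ {f g : A → ℚ} → (∀ x → f x ≡ g x) → ∀ xs → sumOver f xs ≡ sumOver g xs
  sumOver-cong h []       = refl
  sumOver-cong h (x ∷ xs) = cong₂ _+_ (h x) (sumOver-cong h xs)

  sumOver-+ : ∀ (f g : A → ℚ) xs → sumOver (λ x → f x + g x) xs ≡ sumOver f xs + sumOver g xs
  sumOver-+ f g []       = refl
  sumOver-+ f g (x ∷ xs) = trans (cong (f x + g x +_) (sumOver-+ f g xs))
    (solve 4 (λ a b c d → a :+ b :+ (c :+ d) := (a :+ c) :+ (b :+ d)) refl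
      (f x) (g x) (sumOver f xs) (sumOver g xs))

  sumOver-++ : ∀ (f : A → ℚ) xs ys → sumOver f (xs ++ ys) ≡ sumOver f xs + sumOver f ys
  sumOver-++ f []       ys = sym (+-identityˡ _)
  sumOver-++ f (x ∷ xs) ys = trans (cong (f x +_) (sumOver-++ f xs ys)) (sym (+-assoc (f x) _ _))

  sumOver-↭ : ∀ (f : A → ℚ) {xs ys} → xs ↭ ys → sumOver f xs ≡ sumOver f ys
  sumOver-↭ f Perm.refl         = refl
  sumOver-↭ f (Perm.prep x p)   = cong (f x +_) (sumOver-↭ f p)
  sumOver-↭ f (Perm.swap {xs = xs} x y p) = trans
    (solve 3 (λ a b c → a :+ (b :+ c) := b :+ (a :+ c)) refl (f x) (f y) (sumOver f xs))
    (cong (λ s → f y + (f x + s)) (sumOver-↭ f p))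
  sumOver-↭ f (Perm.trans p q)  = trans (sumOver-↭ f p) (sumOver-↭ f q)

  module _ {f : A → ℚ} (0≤f : ∀ x → 0ℚ ≤ f x) where

    0≤sumOver : ∀ xs → 0ℚ ≤ sumOver f xs
    0≤sumOver []       = ≤-refl
    0≤sumOver (x ∷ xs) = 0≤p+q (0≤f x) (0≤sumOver xs)

    ∈⇒≤sumOver : ∀ {x xs} → x ∈ xs → f x ≤ sumOver f xs
    ∈⇒≤sumOver {x} {_ ∷ xs} (here refl) = subst (_≤ f x + sumOver f xs) (+-identityʳ (f x)) (+-monoʳ-≤ (f x) (0≤sumOver xs))
    ∈⇒≤sumOver {x} {y ∷ xs} (there x∈)  = subst (_≤ f y + sumOver f xs) (+-identityˡ (f x)) (+-mono-≤ (0≤f y) (∈⇒≤sumOver x∈))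

    ∈∈⇒≤sumOver : ∀ {x y xs} → x ≢ y → x ∈ xs → y ∈ xs → f x + f y ≤ sumOver f xs
    ∈∈⇒≤sumOver x≢y (here refl) (here refl) = ⊥-elim (x≢y refl)
    ∈∈⇒≤sumOver {x} x≢y (here refl) (there y∈) = +-monoʳ-≤ (f x) (∈⇒≤sumOver y∈)
    ∈∈⇒≤sumOver {x} {y} x≢y (there x∈) (here refl) = subst (_≤ _) (+-comm (f y) (f x)) (+-monoʳ-≤ (f y) (∈⇒≤sumOver x∈))
    ∈∈⇒≤sumOver {x} {y} {z ∷ xs} x≢y (there x∈) (there y∈) =
      subst (_≤ f z + sumOver f xs) (+-identityˡ (f x + f y)) (+-mono-≤ (0≤f z) (∈∈⇒≤sumOver x≢y x∈ y∈))

Σℚ-tabulate : ∀ {A : Set} {n} (f : A → ℚ) (g : Fin n → A) → Σℚ (λ i → f (g i)) ≡ sumOver f (tabulate g)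
Σℚ-tabulate {n = zero}  f g = refl
Σℚ-tabulate {n = suc n} f g = cong (f (g zero) +_) (Σℚ-tabulate f (λ i → g (suc i)))

Σℚ≡sumOver : ∀ {n} (f : Fin n → ℚ) {xs} → xs ↭ allFin n → Σℚ f ≡ sumOver f xs
Σℚ≡sumOver f p = trans (Σℚ-tabulate f (λ i → i)) (sym (sumOver-↭ f p))

module PairEnergy {A : Set} (W : A → A → ℚ) (0≤W : ∀ a b → 0ℚ ≤ W a b)
                  (W-sym : ∀ a b → W a b ≡ W b a) (W-diag : ∀ a → W a a ≡ 0ℚ) where

  -- Each unordered pair of positions is counted once. On lists the energy splits along the
  -- numbering into the energies of two blocks and a `cross` term, which is how edge-disjointness is
  -- expressed.
  energy : List A → ℚ
  energy []      = 0ℚ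
  energy (a ∷ S) = energy S + sumOver (W a) S

  cross : List A → List A → ℚ
  cross S T = sumOver (λ a → sumOver (W a) T) S

  0≤energy : ∀ S → 0ℚ ≤ energy S
  0≤energy []      = ≤-refl
  0≤energy (a ∷ S) = 0≤p+q (0≤energy S) (0≤sumOver (0≤W a) S)

  cross-self : ∀ S → cross S S ≡ energy S + energy S
  cross-self []      = refl
  cross-self (a ∷ S) = begin
    (W a a + s) + sumOver (λ b → W b a + sumOver (W b) S) S
      ≡⟨ cong₂ _+_ (cong (_+ s) (W-diag a)) (sumOver-+ (λ b → W b a) (λ b → sumOver (W b) S) S) ⟩
    (0ℚ + s) + (sumOver (λ b → W b a) S + cross S S)
      ≡⟨ cong₂ (λ p q → (0ℚ + s) + (p + q)) (sumOver-cong (λ b → W-sym b a) S) (cross-self S) ⟩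
    (0ℚ + s) + (s + (energy S + energy S))
      ≡⟨ solve 2 (λ s e → (con 0ℚ :+ s) :+ (s :+ (e :+ e)) := (e :+ s) :+ (e :+ s)) refl s (energy S) ⟩
    energy (a ∷ S) + energy (a ∷ S)  ∎
    where
    open ≡-Reasoning
    s = sumOver (W a) S

  energy-++ : ∀ S T → energy (S ++ T) ≡ (energy S + energy T) + cross S T
  energy-++ []      T = solve 1 (λ e → e := (con 0ℚ :+ e) :+ con 0ℚ) refl (energy T)
  energy-++ (a ∷ S) T = trans (cong₂ _+_ (energy-++ S T) (sumOver-++ (W a) S T))
    (solve 5 (λ s t c p q → ((s :+ t) :+ c) :+ (p :+ q) := ((s :+ p) :+ t) :+ (q :+ c)) refl
      (energy S) (energy T) (cross S T) (sumOver (W a) S) (sumOver (W a) T))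

  ∈∈⇒≤cross : ∀ {a b S T} → a ∈ S → b ∈ T → W a b ≤ cross S T
  ∈∈⇒≤cross {a} {T = T} a∈ b∈ = ≤-trans (∈⇒≤sumOver (0≤W a) b∈)
    (∈⇒≤sumOver (λ c → 0≤sumOver (0≤W c) T) a∈)

  energy-suffix-≤ : ∀ S T → energy T ≤ energy (S ++ T)
  energy-suffix-≤ []      T = ≤-refl
  energy-suffix-≤ (a ∷ S) T = ≤-trans (energy-suffix-≤ S T)
    (subst (_≤ energy (a ∷ S ++ T)) (+-identityʳ _) (+-monoʳ-≤ (energy (S ++ T)) (0≤sumOver (0≤W a) (S ++ T))))

-- Effective resistance bounded through two edge-disjoint paths.

module Resistance {n : ℕ} (G : Graph n) where

  open Numbering G

  0≤⟦⟧ : ∀ b → 0ℚ ≤ ⟦ b ⟧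
  0≤⟦⟧ true  = nonNegative⁻¹ 1ℚ
  0≤⟦⟧ false = ≤-refl

  module _ (x : Fin n → ℚ) where

    W : Fin n → Fin n → ℚ
    W i j = ⟦ adj G i j ⟧ * ((x i - x j) * (x i - x j))

    W-sym : ∀ i j → W i j ≡ W j i
    W-sym i j = trans (cong (λ b → ⟦ b ⟧ * ((x i - x j) * (x i - x j))) (adj-sym G i j))
      (solve 3 (λ c a b → c :* ((a :- b) :* (a :- b)) := c :* ((b :- a) :* (b :- a))) refl ⟦ adj G j i ⟧ (x i) (x j))

    W-diag : ∀ i → W i i ≡ 0ℚ
    W-diag i = trans (cong (λ b → ⟦ b ⟧ * ((x i - x i) * (x i - x i))) (irrefl G i)) (*-zeroˡ ((x i - x i) * (x i - x i)))

    0≤W : ∀ i j → 0ℚ ≤ W i j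
    0≤W i j = 0≤p*q (0≤⟦⟧ (adj G i j)) (0≤p*p (x i - x j))

    open PairEnergy W 0≤W W-sym W-diag public

    W-edge : ∀ {i j} → i ~ j → W i j ≡ (x i - x j) * (x i - x j)
    W-edge {i} {j} i~j = trans (cong (λ b → ⟦ b ⟧ * ((x i - x j) * (x i - x j))) i~j) (*-identityˡ _)

    -- Cauchy-Schwarz along the chain of parents from `v` to `r`: it has at most `length S - 1`
    -- edges, all between entries of `S`. The proof is mutual with `edge-drop-≤`, which appends one
    -- edge by `series-≤`.
    tree-drop-≤ : ∀ {r S v} → Tree r S → v ∈ S →
      (x v - x r) * (x v - x r) ≤ fromℕ (ℕ.pred (length S)) * energy S

    edge-drop-≤ : ∀ {r S v w} → Tree r S → w ∈ S → v ~ w →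
      (x v - x r) * (x v - x r) ≤ fromℕ (length S) * (energy S + W v w)
    edge-drop-≤ {r} {S@(_ ∷ S′)} {v} {w} τ w∈ v~w = subst (_≤ fromℕ (length S) * (energy S + W v w))
      (solve 3 (λ v w r → ((w :- r) :+ (v :- w)) :* ((w :- r) :+ (v :- w)) := (v :- r) :* (v :- r)) refl (x v) (x w) (x r))
      (series-≤ (length S′) {x w - x r} {x v - x w} (tree-drop-≤ τ w∈) (≤-reflexive (sym (W-edge v~w))) (0≤energy S))

    tree-drop-≤ {r} root (here refl) = ≤-reflexive
      (solve 1 (λ r → (r :- r) :* (r :- r) := con 0ℚ :* (con 0ℚ :+ con 0ℚ)) refl (x r))
    tree-drop-≤ (node {v} {w} {S} w∈ v~w τ) (here refl) = ≤-trans (edge-drop-≤ τ w∈ v~w)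
      (*-mono-≤ˡ (0≤fromℕ (length S)) (+-monoʳ-≤ (energy S) (∈⇒≤sumOver (0≤W v) w∈)))
    -- The chain starts further down the list and misses the head; adding the energy at the head and
    -- raising the factor by one only enlarge the right side.
    tree-drop-≤ (node {v} {S = S@(_ ∷ S′)} _ _ τ) (there v∈) = ≤-trans (tree-drop-≤ τ v∈) (≤-trans
      (*-mono-≤ˡ (0≤fromℕ (length S′)) (energy-suffix-≤ [ v ] S))
      (subst (_≤ fromℕ (length S) * energy (v ∷ S)) (*-comm (energy (v ∷ S)) (fromℕ (length S′)))
        (subst (energy (v ∷ S) * fromℕ (length S′) ≤_) (*-comm (energy (v ∷ S)) (fromℕ (length S)))
          (*-mono-≤ˡ (0≤energy (v ∷ S)) (p≤1+p (fromℕ (length S′)))))))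
      where
      p≤1+p : ∀ p → p ≤ 1ℚ + p
      p≤1+p p = subst (_≤ 1ℚ + p) (+-identityˡ p) (+-monoˡ-≤ p (nonNegative⁻¹ 1ℚ))

    -- Summation by parts. Twice the energy is the sum of all `W i j`, and `W i j` is
    -- `F i j + F j i`, where row `i` of `F` sums to `x i` times the net current at `i`. By
    -- Kirchhoff's law only `u` and `v` contribute.
    energy≡drop : ∀ {u v M} → (∀ i → laplacian G x i ≡ δ i u - δ i v) → M ↭ allFin n →
      energy M ≡ x u - x v
    energy≡drop {u} {v} {M} kirchhoff p = double-injective (begin
      energy M + energy M                 ≡⟨ cross-self M ⟨
      cross M M                           ≡⟨ sumOver-cong (λ i → sym (Σℚ≡sumOver (W i) p)) M ⟩
      sumOver (λ i → Σℚ (W i)) M          ≡⟨ Σℚ≡sumOver (λ i → Σℚ (W i)) p ⟨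
      Σℚ (λ i → Σℚ (W i))                 ≡⟨ Σℚ-cong (λ i → Σℚ-cong (split i)) ⟩
      Σℚ (λ i → Σℚ (λ j → F i j + F j i)) ≡⟨ Σℚ-cong (λ i → Σℚ-+ (F i) (λ j → F j i)) ⟩
      Σℚ (λ i → Σℚ (F i) + Σℚ (λ j → F j i))
        ≡⟨ Σℚ-+ (λ i → Σℚ (F i)) (λ i → Σℚ (λ j → F j i)) ⟩
      Σℚ (λ i → Σℚ (F i)) + Σℚ (λ i → Σℚ (λ j → F j i))
        ≡⟨ cong (Σℚ (λ i → Σℚ (F i)) +_) (Σℚ-comm (λ i j → F j i)) ⟩
      Σℚ (λ i → Σℚ (F i)) + Σℚ (λ i → Σℚ (F i))
        ≡⟨ cong₂ _+_ total total ⟩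
      (x u - x v) + (x u - x v)           ∎)
      where
      open ≡-Reasoning
      F : Fin n → Fin n → ℚ
      F i j = ⟦ adj G i j ⟧ * (x i - x j) * x i
      split : ∀ i j → W i j ≡ F i j + F j i
      split i j = trans
        (solve 3 (λ c a b → c :* ((a :- b) :* (a :- b)) := c :* (a :- b) :* a :+ c :* (b :- a) :* b) refl
          ⟦ adj G i j ⟧ (x i) (x j))
        (cong (λ b → F i j + ⟦ b ⟧ * (x j - x i) * x j) (adj-sym G i j))
      total : Σℚ (λ i → Σℚ (F i)) ≡ x u - x v
      total = begin
        Σℚ (λ i → Σℚ (F i))
          ≡⟨ Σℚ-cong (λ i → trans (Σℚ-*ʳ (λ j → ⟦ adj G i j ⟧ * (x i - x j)) (x i)) (cong (_* x i) (kirchhoff i))) ⟩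
        Σℚ (λ i → (δ i u - δ i v) * x i)
          ≡⟨ Σℚ-cong (λ i → solve 3 (λ a b c → (a :- b) :* c := a :* c :+ b :* c :* con (- 1ℚ)) refl (δ i u) (δ i v) (x i)) ⟩
        Σℚ (λ i → δ i u * x i + δ i v * x i * - 1ℚ)
          ≡⟨ Σℚ-+ (λ i → δ i u * x i) (λ i → δ i v * x i * - 1ℚ) ⟩
        Σℚ (λ i → δ i u * x i) + Σℚ (λ i → δ i v * x i * - 1ℚ)
          ≡⟨ cong₂ _+_ (Σℚ-δ u x) (trans (Σℚ-*ʳ (λ i → δ i v * x i) (- 1ℚ)) (cong (_* - 1ℚ) (Σℚ-δ v x))) ⟩
        x u + x v * - 1ℚ
          ≡⟨ solve 2 (λ a b → a :+ b :* con (- 1ℚ) := a :- b) refl (x u) (x v) ⟩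
        x u - x v  ∎
      double-injective : ∀ {p q} → p + p ≡ q + q → p ≡ q
      double-injective {p} {q} eq = begin
        p            ≡⟨ solve 1 (λ p → p := con ½ :* (p :+ p)) refl p ⟩
        ½ * (p + p)  ≡⟨ cong (½ *_) eq ⟩
        ½ * (q + q)  ≡⟨ solve 1 (λ p → con ½ :* (p :+ p) := p) refl q ⟩
        q            ∎

  tree-root∈-tail : ∀ {r v b B} → Tree r (v ∷ B) → b ∈ B → r ∈ B
  tree-root∈-tail (node _ _ τ) _ = tree-root∈ τ

  -- One path runs inside `w ∷ A₂` from `u` to `w` and then along `wv`, the other from `v` inside
  -- `v ∷ B` to `t` and then along `tu`. Their energies `α` and `β` use different pairs, provided
  -- `vw` is not the edge `tu`; this is the disjunctive hypothesis.
  resistance-≤ : ∀ {u t v w r} A₁ A₂ B → u ~ t → v ~ w →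
    Tree u (A₁ ++ w ∷ A₂) → Tree t (v ∷ B) → v ∷ (A₁ ++ w ∷ A₂) ++ B ↭ allFin n →
    w ≢ u ⊎ (∃ λ b → b ∈ B) → IsResistance G u v r →
    (fromℕ (suc (length A₂)) + fromℕ (suc (length B))) * r ≤ fromℕ (suc (length A₂)) * fromℕ (suc (length B))
  resistance-≤ {u} {t} {v} {w} {r} A₁ A₂ B u~t v~w τ τ′ p sep (x , kirchhoff , refl) =
    parallel-≤ {k} {l} {x u - x v} {α} {β} (0≤fromℕ (suc (length A₂))) (0≤fromℕ (suc (length B)))
      (subst (0ℚ ≤_) (energy≡drop x kirchhoff p) (0≤energy x (v ∷ A ++ B)))
      lower upper (≤-trans (total B τ′ sep) (≤-reflexive (energy≡drop x kirchhoff p)))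
    where
    A = A₁ ++ w ∷ A₂
    α = energy x (w ∷ A₂) + W x v w
    β = energy x (v ∷ B) + W x t u
    k = fromℕ (suc (length A₂))
    l = fromℕ (suc (length B))
    lower : (x u - x v) * (x u - x v) ≤ k * α
    lower = subst (_≤ k * α)
      (solve 2 (λ a b → (b :- a) :* (b :- a) := (a :- b) :* (a :- b)) refl (x u) (x v))
      (edge-drop-≤ x (tree-suffix A₁ (here refl) τ) (here refl) v~w)
    upper : (x u - x v) * (x u - x v) ≤ l * β
    upper = subst (_≤ l * β)
      (solve 3 (λ u v t → ((v :- t) :+ (t :- u)) :* ((v :- t) :+ (t :- u)) := (u :- v) :* (u :- v)) refl
        (x u) (x v) (x t))
      (series-≤ (length B) {x v - x t} {x t - x u} (tree-drop-≤ x τ′ (here refl))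
        (≤-reflexive (sym (W-edge x (~-sym u~t)))) (0≤energy x (v ∷ B)))
    w∈A = ∈-insert A₁
    disjoint : ∀ B {b} → Tree t (v ∷ B) → b ∈ B →
      energy x (w ∷ A₂) + W x v w + (energy x (v ∷ B) + W x t u) ≤ energy x (v ∷ A ++ B)
    disjoint B τ′ b∈ = begin
      energy x (w ∷ A₂) + W x v w + (energy x (v ∷ B) + W x t u)
        -- Since `B` is nonempty it contains `t`, so the edge `tu` is counted in `cross x A B`,
        -- separately from the pairs at `v`.
        ≤⟨ +-mono-≤ (+-mono-≤ (energy-suffix-≤ x A₁ (w ∷ A₂)) (∈⇒≤sumOver (0≤W x v) w∈A))
             (+-monoʳ-≤ (energy x (v ∷ B)) (≤-trans (≤-reflexive (W-sym x t u))
               (∈∈⇒≤cross x (tree-root∈ τ) (tree-root∈-tail τ′ b∈)))) ⟩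
      energy x A + sumOver (W x v) A + (energy x B + sumOver (W x v) B + cross x A B)
        ≡⟨ solve 5 (λ a p b q c → a :+ p :+ (b :+ q :+ c) := (a :+ b :+ c) :+ (p :+ q)) refl
             (energy x A) (sumOver (W x v) A) (energy x B) (sumOver (W x v) B) (cross x A B) ⟩
      (energy x A + energy x B + cross x A B) + (sumOver (W x v) A + sumOver (W x v) B)
        ≡⟨ cong₂ _+_ (energy-++ x A B) (sumOver-++ (W x v) A B) ⟨
      energy x (v ∷ A ++ B)  ∎
      where open ≤-Reasoning
    total : ∀ B → Tree t (v ∷ B) → w ≢ u ⊎ (∃ λ b → b ∈ B) →
      energy x (w ∷ A₂) + W x v w + (energy x (v ∷ B) + W x t u) ≤ energy x (v ∷ A ++ B)
    total (b ∷ B) τ′   _          = disjoint (b ∷ B) τ′ (here refl)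
    -- Here `v` is `t`, so both `vw` and `tu` join `v` to an entry of `A`, and `w≢u` makes them two
    -- different summands.
    total []      root (inj₁ w≢u) = begin
      energy x (w ∷ A₂) + W x v w + (0ℚ + 0ℚ + W x v u)
        ≡⟨ solve 3 (λ e p q → e :+ p :+ (con 0ℚ :+ con 0ℚ :+ q) := e :+ (p :+ q)) refl (energy x (w ∷ A₂)) (W x v w) (W x v u) ⟩
      energy x (w ∷ A₂) + (W x v w + W x v u)
        ≤⟨ +-mono-≤ (energy-suffix-≤ x A₁ (w ∷ A₂)) (∈∈⇒≤sumOver (0≤W x v) w≢u w∈A (tree-root∈ τ)) ⟩
      energy x (v ∷ A)        ≡⟨ cong (λ S → energy x (v ∷ S)) (++-identityʳ A) ⟨
      energy x (v ∷ A ++ [])  ∎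
      where open ≤-Reasoning

-- The cycle

-- The offset `a` makes the induction work: removing the first summand shifts it by one. The right
-- side expands the summand in `i` and inserts m(m - 1)/2 and m(m - 1)(2m - 1)/6 for the sums of `i`
-- and of its square.
Σ-quadratic : ∀ m a N →
  fromℕ 6 * Σℚ {m} (λ i → (a + fromℕ (toℕ i)) * (N - (a + fromℕ (toℕ i)))) ≡
  fromℕ 6 * (fromℕ m * (a * (N - a))) + fromℕ 3 * ((N - (a + a)) * (fromℕ m * (fromℕ m - 1ℚ)))
    - fromℕ m * (fromℕ m - 1ℚ) * (fromℕ m + fromℕ m - 1ℚ)
Σ-quadratic zero a N =
  solve 2 (λ a N → con (fromℕ 6) :* con 0ℚ :=
    con (fromℕ 6) :* (con 0ℚ :* (a :* (N :- a))) :+ con (fromℕ 3) :* ((N :- (a :+ a)) :* (con 0ℚ :* (con 0ℚ :- con 1ℚ)))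
      :- con 0ℚ :* (con 0ℚ :- con 1ℚ) :* (con 0ℚ :+ con 0ℚ :- con 1ℚ)) refl a N
Σ-quadratic (suc m) a N = begin
  fromℕ 6 * ((a + 0ℚ) * (N - (a + 0ℚ)) + Σℚ {m} (λ i → f (a + (1ℚ + fromℕ (toℕ i)))))
    ≡⟨ cong (λ s → fromℕ 6 * ((a + 0ℚ) * (N - (a + 0ℚ)) + s))
         (Σℚ-cong {m} (λ i → cong f (sym (+-assoc a 1ℚ (fromℕ (toℕ i)))))) ⟩
  fromℕ 6 * ((a + 0ℚ) * (N - (a + 0ℚ)) + s)
    ≡⟨ *-distribˡ-+ (fromℕ 6) ((a + 0ℚ) * (N - (a + 0ℚ))) s ⟩
  fromℕ 6 * ((a + 0ℚ) * (N - (a + 0ℚ))) + fromℕ 6 * s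
    ≡⟨ cong (fromℕ 6 * ((a + 0ℚ) * (N - (a + 0ℚ))) +_) (Σ-quadratic m (a + 1ℚ) N) ⟩
  _ ≡⟨ solve 3 (λ a N M → con (fromℕ 6) :* ((a :+ con 0ℚ) :* (N :- (a :+ con 0ℚ))) :+
         (con (fromℕ 6) :* (M :* ((a :+ con 1ℚ) :* (N :- (a :+ con 1ℚ))))
           :+ con (fromℕ 3) :* ((N :- ((a :+ con 1ℚ) :+ (a :+ con 1ℚ))) :* (M :* (M :- con 1ℚ)))
           :- M :* (M :- con 1ℚ) :* (M :+ M :- con 1ℚ)) :=
         con (fromℕ 6) :* ((con 1ℚ :+ M) :* (a :* (N :- a)))
           :+ con (fromℕ 3) :* ((N :- (a :+ a)) :* ((con 1ℚ :+ M) :* ((con 1ℚ :+ M) :- con 1ℚ)))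
           :- (con 1ℚ :+ M) :* ((con 1ℚ :+ M) :- con 1ℚ) :* ((con 1ℚ :+ M) :+ (con 1ℚ :+ M) :- con 1ℚ))
         refl a N (fromℕ m) ⟩
  _ ∎
  where
  open ≡-Reasoning
  f : ℚ → ℚ
  f b = b * (N - b)
  s = Σℚ {m} (λ i → f (a + 1ℚ + fromℕ (toℕ i)))

recip : ℕ → ℚ
recip m = (1/ fromℕ (suc m)) {{pos⇒nonZero (fromℕ (suc m)) {{positive (0<fromℕ m)}}}}

recip-inverse : ∀ m → fromℕ (suc m) * recip m ≡ 1ℚ
recip-inverse m = *-inverseʳ (fromℕ (suc m)) {{pos⇒nonZero (fromℕ (suc m)) {{positive (0<fromℕ m)}}}}

-- The resistance k (n - k) / n across k edges of the cycle of length n = suc m.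
cycleRes : ℕ → ℕ → ℚ
cycleRes m k = fromℕ k * (fromℕ (suc m) - fromℕ k) * recip m

n*cycleRes : ∀ m k → fromℕ (suc m) * cycleRes m k ≡ fromℕ k * (fromℕ (suc m) - fromℕ k)
n*cycleRes m k = begin
  N * (q * recip m)   ≡⟨ solve 3 (λ n q r → n :* (q :* r) := q :* (n :* r)) refl N q (recip m) ⟩
  q * (N * recip m)   ≡⟨ cong (q *_) (recip-inverse m) ⟩
  q * 1ℚ              ≡⟨ *-identityʳ q ⟩
  q                   ∎
  where
  open ≡-Reasoning
  N = fromℕ (suc m)
  q = fromℕ k * (N - fromℕ k)

*-cancelˡ-≡ : ∀ {c p q} → 0ℚ < c → c * p ≡ c * q → p ≡ q
*-cancelˡ-≡ 0<c eq = ≤-antisym (*-cancel-≤ˡ 0<c (≤-reflexive eq)) (*-cancel-≤ˡ 0<c (≤-reflexive (sym eq)))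

-- For `a = 0` and as many terms as `N`, the closed form of `Σ-quadratic` collapses to N(N² - 1);
-- the factor `recip m` removes the `N`.
Σ-cycleRes : ∀ m → Σℚ {suc m} (λ i → cycleRes m (toℕ i)) ≡ bound (suc m)
Σ-cycleRes m = *-cancelˡ-≡ (0<fromℕ 5) (begin
  fromℕ 6 * Σℚ {suc m} (λ i → cycleRes m (toℕ i))
    ≡⟨ cong (fromℕ 6 *_) (trans (Σℚ-*ʳ {suc m} (λ i → fromℕ (toℕ i) * (N - fromℕ (toℕ i))) (recip m))
         (cong (_* recip m) (Σℚ-cong {suc m} (λ i → cong (λ b → b * (N - b)) (sym (+-identityˡ (fromℕ (toℕ i)))))))) ⟩
  fromℕ 6 * (s * recip m)
    ≡⟨ *-assoc (fromℕ 6) s (recip m) ⟨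
  fromℕ 6 * s * recip m
    ≡⟨ cong (_* recip m) (Σ-quadratic (suc m) 0ℚ N) ⟩
  _ ≡⟨ solve 2 (λ N r → (con (fromℕ 6) :* (N :* (con 0ℚ :* (N :- con 0ℚ)))
           :+ con (fromℕ 3) :* ((N :- (con 0ℚ :+ con 0ℚ)) :* (N :* (N :- con 1ℚ)))
           :- N :* (N :- con 1ℚ) :* (N :+ N :- con 1ℚ)) :* r
           := (N :* r) :* (N :* N :- con 1ℚ)) refl N (recip m) ⟩
  (N * recip m) * (N * N - 1ℚ)
    ≡⟨ cong (_* (N * N - 1ℚ)) (recip-inverse m) ⟩
  1ℚ * (N * N - 1ℚ)
    ≡⟨ *-identityˡ (N * N - 1ℚ) ⟩
  N * N - 1ℚ
    ≡⟨ 6*bound m ⟨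
  fromℕ 6 * bound (suc m) ∎)
  where
  open ≡-Reasoning
  N = fromℕ (suc m)
  s = Σℚ {suc m} (λ i → (0ℚ + fromℕ (toℕ i)) * (N - (0ℚ + fromℕ (toℕ i))))

-- Kirchhoff's law for an explicit potential on the cycle.

⟦∨⟧ : ∀ {A B : Set} → (A → B → ⊥) → (a? : Dec A) (b? : Dec B) → ⟦ does a? ∨ does b? ⟧ ≡ ⟦ does a? ⟧ + ⟦ does b? ⟧
⟦∨⟧ ¬ab (yes a) (yes b) = ⊥-elim (¬ab a b)
⟦∨⟧ ¬ab (yes a) (no _)  = refl
⟦∨⟧ ¬ab (no _)  (yes b) = refl
⟦∨⟧ ¬ab (no _)  (no _)  = refl

≡ᵇ-sym : ∀ m n → (m ≡ᵇ n) ≡ (n ≡ᵇ m)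
≡ᵇ-sym zero    zero    = refl
≡ᵇ-sym zero    (suc n) = refl
≡ᵇ-sym (suc m) zero    = refl
≡ᵇ-sym (suc m) (suc n) = ≡ᵇ-sym m n

Σℚ-0* : ∀ {n} (f : Fin n → ℚ) → Σℚ (λ i → 0ℚ * f i) ≡ 0ℚ
Σℚ-0* {n} f = trans (Σℚ-cong (λ i → *-zeroˡ (f i))) (Σℚ-0 n)

Σℚ-pick : ∀ {n m} → m ℕ.< n → (f : ℕ → ℚ) → Σℚ {n} (λ j → ⟦ toℕ j ≡ᵇ m ⟧ * f (toℕ j)) ≡ f m
Σℚ-pick {suc n} {zero} _ f = trans (cong₂ _+_ (*-identityˡ (f 0)) (Σℚ-0* {n} (λ j → f (suc (toℕ j))))) (+-identityʳ (f 0))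
Σℚ-pick {suc n} {suc m} (s≤s m<n) f =
  trans (cong₂ _+_ (*-zeroˡ (f 0)) (Σℚ-pick m<n (λ j → f (suc j)))) (+-identityˡ (f (suc m)))

-- This serves the last vertex of the cycle, whose successor index `n` is out of range.
Σℚ-pick-none : ∀ n (f : ℕ → ℚ) → Σℚ {n} (λ j → ⟦ toℕ j ≡ᵇ n ⟧ * f (toℕ j)) ≡ 0ℚ
Σℚ-pick-none zero    f = refl
Σℚ-pick-none (suc n) f = trans (cong₂ _+_ (*-zeroˡ (f 0)) (Σℚ-pick-none n (λ j → f (suc j)))) (+-identityˡ 0ℚ)

δ≡⟦≡ᵇ⟧ : ∀ {n} (i j : Fin n) → δ i j ≡ ⟦ toℕ i ≡ᵇ toℕ j ⟧
δ≡⟦≡ᵇ⟧ zero    zero    = refl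
δ≡⟦≡ᵇ⟧ zero    (suc j) = refl
δ≡⟦≡ᵇ⟧ (suc i) zero    = refl
δ≡⟦≡ᵇ⟧ (suc i) (suc j) = δ≡⟦≡ᵇ⟧ i j

-- As a function of the index, the minimum with `k` has slope 1 up to `k` and slope 0 afterwards, so
-- its second difference is a single unit at the kink. This is the current leaving at `k`; the
-- linear part of `potential` contributes nothing.
⊓-second-difference : ∀ i k →
  fromℕ (suc (suc i) ⊓ k) + fromℕ (i ⊓ k) - (fromℕ (suc i ⊓ k) + fromℕ (suc i ⊓ k)) ≡ 0ℚ - ⟦ suc i ≡ᵇ k ⟧
⊓-second-difference zero    zero          = refl
⊓-second-difference (suc i) zero          = refl
⊓-second-difference zero    (suc zero)    = refl
⊓-second-difference zero    (suc (suc k)) = refl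
⊓-second-difference (suc i) (suc k)       = trans
  (solve 3 (λ a b c → (con 1ℚ :+ a) :+ (con 1ℚ :+ b) :- ((con 1ℚ :+ c) :+ (con 1ℚ :+ c)) := a :+ b :- (c :+ c)) refl
    (fromℕ (suc (suc i) ⊓ k)) (fromℕ (i ⊓ k)) (fromℕ (suc i ⊓ k)))
  (⊓-second-difference i k)

fromℕ[1⊓k] : ∀ k → fromℕ (1 ⊓ k) ≡ 1ℚ - ⟦ 0 ≡ᵇ k ⟧
fromℕ[1⊓k] zero    = refl
fromℕ[1⊓k] (suc k) = refl

module Cycle (m : ℕ) where

  n-1 n : ℕ
  n-1 = suc (suc m)
  n   = suc n-1

  -- Potential of the cycle for a unit current from 0 to k: it falls by 1 - k/n
  -- along each of the first k edges and rises by k/n along the others.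
  potential : ℕ → ℕ → ℚ
  potential k j = fromℕ j * (fromℕ k * recip n-1) - fromℕ (j ⊓ k)

  module _ (k : ℕ) (k≤n-1 : k ℕ.≤ n-1) where

    private
      x = potential k
      c = fromℕ k * recip n-1

    N*c : fromℕ n * c ≡ fromℕ k
    N*c = trans (solve 3 (λ N k r → N :* (k :* r) := k :* (N :* r)) refl (fromℕ n) (fromℕ k) (recip n-1))
      (trans (cong (fromℕ k *_) (recip-inverse n-1)) (*-identityʳ (fromℕ k)))

    potential-0 : x 0 ≡ 0ℚ
    potential-0 = solve 1 (λ c → con 0ℚ :* c :- con 0ℚ := con 0ℚ) refl c

    -- The slope `c` is chosen for this: the values at `0` and at the fictitious index `n` agree, so
    -- the potential closes up around the cycle and the last vertex can be treated like an interior
    -- one.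
    potential-n : x n ≡ 0ℚ
    potential-n = trans (cong₂ (λ a b → a - fromℕ b) N*c (ℕ.m≥n⇒m⊓n≡n (ℕ.m≤n⇒m≤1+n k≤n-1)))
      (+-inverseʳ (fromℕ k))

    laplace-interior : ∀ i → (x (suc i) - x (suc (suc i))) + (x (suc i) - x i) ≡ 0ℚ - ⟦ suc i ≡ᵇ k ⟧
    laplace-interior i = trans
      (solve 5 (λ I c p q r →
         (((con 1ℚ :+ I) :* c :- q) :- ((con 1ℚ :+ (con 1ℚ :+ I)) :* c :- p))
           :+ (((con 1ℚ :+ I) :* c :- q) :- (I :* c :- r))
         := p :+ r :- (q :+ q)) refl
        (fromℕ i) c (fromℕ (suc (suc i) ⊓ k)) (fromℕ (suc i ⊓ k)) (fromℕ (i ⊓ k)))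
      (⊓-second-difference i k)

    laplace-0 : (x 0 - x 1) + (x 0 - x n-1) ≡ 1ℚ - ⟦ 0 ≡ᵇ k ⟧
    laplace-0 = begin
      (x 0 - x 1) + (x 0 - x n-1)
        ≡⟨ cong (λ j → (x 0 - x 1) + (x 0 - (fromℕ n-1 * c - fromℕ j))) (ℕ.m≥n⇒m⊓n≡n k≤n-1) ⟩
      (x 0 - x 1) + (x 0 - (fromℕ n-1 * c - fromℕ k))
        ≡⟨ solve 4 (λ M c p k → ((con 0ℚ :* c :- con 0ℚ) :- (con 1ℚ :* c :- p)) :+ ((con 0ℚ :* c :- con 0ℚ) :- (M :* c :- k))
             := p :+ (k :- (con 1ℚ :+ M) :* c)) refl (fromℕ n-1) c (fromℕ (1 ⊓ k)) (fromℕ k) ⟩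
      fromℕ (1 ⊓ k) + (fromℕ k - fromℕ n * c)
        ≡⟨ cong₂ (λ p q → p + (fromℕ k - q)) (fromℕ[1⊓k] k) N*c ⟩
      1ℚ - ⟦ 0 ≡ᵇ k ⟧ + (fromℕ k - fromℕ k)
        ≡⟨ solve 2 (λ p k → p :+ (k :- k) := p) refl (1ℚ - ⟦ 0 ≡ᵇ k ⟧) (fromℕ k) ⟩
      1ℚ - ⟦ 0 ≡ᵇ k ⟧ ∎
      where open ≡-Reasoning

    potential-drop : x 0 - x k ≡ cycleRes n-1 k
    potential-drop = begin
      x 0 - x k
        ≡⟨ cong (λ j → x 0 - (fromℕ k * c - fromℕ j)) (ℕ.⊓-idem k) ⟩
      x 0 - (fromℕ k * c - fromℕ k)
        ≡⟨ solve 3 (λ k r z → (con 0ℚ :* z :- con 0ℚ) :- (k :* (k :* r) :- k) := k :* con 1ℚ :- k :* k :* r) refl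
             (fromℕ k) (recip n-1) c ⟩
      fromℕ k * 1ℚ - fromℕ k * fromℕ k * recip n-1
        ≡⟨ cong (λ o → fromℕ k * o - fromℕ k * fromℕ k * recip n-1) (recip-inverse n-1) ⟨
      fromℕ k * (fromℕ n * recip n-1) - fromℕ k * fromℕ k * recip n-1
        ≡⟨ solve 3 (λ k N r → k :* (N :* r) :- k :* k :* r := k :* (N :- k) :* r) refl (fromℕ k) (fromℕ n) (recip n-1) ⟩
      cycleRes n-1 k ∎
      where open ≡-Reasoning

    -- The four clauses exclude one another because `n-1` is at least 2; if it were 1, the
    -- wrap-around edge would also join consecutive indices and be counted twice.
    cycle-indicator : ∀ i j → ⟦ (j ≡ᵇ suc i) ∨ (i ≡ᵇ suc j) ∨ ((i ≡ᵇ 0) ∧ (j ≡ᵇ n-1)) ∨ ((j ≡ᵇ 0) ∧ (i ≡ᵇ n-1)) ⟧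
      ≡ ⟦ j ≡ᵇ suc i ⟧ + (⟦ i ≡ᵇ suc j ⟧ + (⟦ (i ≡ᵇ 0) ∧ (j ≡ᵇ n-1) ⟧ + ⟦ (j ≡ᵇ 0) ∧ (i ≡ᵇ n-1) ⟧))
    cycle-indicator i j = trans (⟦∨⟧ excl₁ a? (b? ⊎-dec (c? ⊎-dec d?)))
      (cong (⟦ j ≡ᵇ suc i ⟧ +_) (trans (⟦∨⟧ excl₂ b? (c? ⊎-dec d?))
        (cong (⟦ i ≡ᵇ suc j ⟧ +_) (⟦∨⟧ (λ { (refl , _) (_ , ()) }) c? d?))))
      where
      a? = j ℕ.≟ suc i
      b? = i ℕ.≟ suc j
      c? = (i ℕ.≟ 0) ×-dec (j ℕ.≟ n-1)
      d? = (j ℕ.≟ 0) ×-dec (i ℕ.≟ n-1)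
      excl₁ : j ≡ suc i → i ≡ suc j ⊎ (i ≡ 0 × j ≡ n-1 ⊎ j ≡ 0 × i ≡ n-1) → ⊥
      excl₁ refl (inj₁ ())
      excl₁ refl (inj₂ (inj₁ (refl , ())))
      excl₂ : i ≡ suc j → i ≡ 0 × j ≡ n-1 ⊎ j ≡ 0 × i ≡ n-1 → ⊥
      excl₂ refl (inj₂ (refl , ()))

    cycle-laplacian : ∀ i → i ℕ.< n → 
      Σℚ {n} (λ j → ⟦ (toℕ j ≡ᵇ suc i) ∨ (i ≡ᵇ suc (toℕ j)) ∨ ((i ≡ᵇ 0) ∧ (toℕ j ≡ᵇ n-1)) ∨ ((toℕ j ≡ᵇ 0) ∧ (i ≡ᵇ n-1)) ⟧
        * (x i - x (toℕ j))) ≡ ⟦ i ≡ᵇ 0 ⟧ - ⟦ i ≡ᵇ k ⟧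
    cycle-laplacian i i<n = begin
      Σℚ {n} (λ j → ⟦ a j ∨ b j ∨ c′ j ∨ d j ⟧ * g j)
        ≡⟨ Σℚ-cong {n} (λ j → trans (cong (_* g j) (cycle-indicator i (toℕ j))) (distrib j)) ⟩
      Σℚ {n} (λ j → ⟦ a j ⟧ * g j + (⟦ b j ⟧ * g j + (⟦ c′ j ⟧ * g j + ⟦ d j ⟧ * g j)))
        ≡⟨ trans (Σℚ-+ {n} (λ j → ⟦ a j ⟧ * g j) (λ j → ⟦ b j ⟧ * g j + (⟦ c′ j ⟧ * g j + ⟦ d j ⟧ * g j)))
             (cong (ΣA +_) (trans (Σℚ-+ {n} (λ j → ⟦ b j ⟧ * g j) (λ j → ⟦ c′ j ⟧ * g j + ⟦ d j ⟧ * g j))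
               (cong (ΣB +_) (Σℚ-+ {n} (λ j → ⟦ c′ j ⟧ * g j) (λ j → ⟦ d j ⟧ * g j))))) ⟩
      ΣA + (ΣB + (ΣC + ΣD))
        ≡⟨ evaluate i i<n ⟩
      ⟦ i ≡ᵇ 0 ⟧ - ⟦ i ≡ᵇ k ⟧ ∎
      where
      open ≡-Reasoning
      g : Fin n → ℚ
      g j = x i - x (toℕ j)
      a b c′ d : Fin n → Bool
      a j  = toℕ j ≡ᵇ suc i
      b j  = i ≡ᵇ suc (toℕ j)
      c′ j = (i ≡ᵇ 0) ∧ (toℕ j ≡ᵇ n-1)
      d j  = (toℕ j ≡ᵇ 0) ∧ (i ≡ᵇ n-1)
      ΣA = Σℚ {n} (λ j → ⟦ a j ⟧ * g j)
      ΣB = Σℚ {n} (λ j → ⟦ b j ⟧ * g j)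
      ΣC = Σℚ {n} (λ j → ⟦ c′ j ⟧ * g j)
      ΣD = Σℚ {n} (λ j → ⟦ d j ⟧ * g j)
      distrib : ∀ j → (⟦ a j ⟧ + (⟦ b j ⟧ + (⟦ c′ j ⟧ + ⟦ d j ⟧))) * g j ≡
        ⟦ a j ⟧ * g j + (⟦ b j ⟧ * g j + (⟦ c′ j ⟧ * g j + ⟦ d j ⟧ * g j))
      distrib j = solve 5 (λ a b c d g → (a :+ (b :+ (c :+ d))) :* g := a :* g :+ (b :* g :+ (c :* g :+ d :* g))) refl
        ⟦ a j ⟧ ⟦ b j ⟧ ⟦ c′ j ⟧ ⟦ d j ⟧ (g j)
      Σ-∧ : ∀ i e {e′} → e ≡ e′ → Σℚ {n} (λ j → ⟦ (toℕ j ≡ᵇ 0) ∧ e ⟧ * (x i - x (toℕ j))) ≡ ⟦ e′ ⟧ * (x i - x 0)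
      Σ-∧ i true  refl = trans (Σℚ-cong {n} (λ j → cong (λ p → ⟦ p ⟧ * (x i - x (toℕ j))) (∧-identityʳ (toℕ j ≡ᵇ 0))))
        (trans (Σℚ-pick {n} {0} (s≤s z≤n) (λ j → x i - x j)) (sym (*-identityˡ (x i - x 0))))
      Σ-∧ i false refl = trans (Σℚ-cong {n} (λ j → cong (λ p → ⟦ p ⟧ * (x i - x (toℕ j))) (∧-zeroʳ (toℕ j ≡ᵇ 0))))
        (trans (Σℚ-0* {n} (λ j → x i - x (toℕ j))) (sym (*-zeroˡ (x i - x 0))))
      evaluate : ∀ i → i ℕ.< n →
        Σℚ {n} (λ j → ⟦ toℕ j ≡ᵇ suc i ⟧ * (x i - x (toℕ j))) +
          (Σℚ {n} (λ j → ⟦ i ≡ᵇ suc (toℕ j) ⟧ * (x i - x (toℕ j))) +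
          (Σℚ {n} (λ j → ⟦ (i ≡ᵇ 0) ∧ (toℕ j ≡ᵇ n-1) ⟧ * (x i - x (toℕ j))) +
           Σℚ {n} (λ j → ⟦ (toℕ j ≡ᵇ 0) ∧ (i ≡ᵇ n-1) ⟧ * (x i - x (toℕ j)))))
        ≡ ⟦ i ≡ᵇ 0 ⟧ - ⟦ i ≡ᵇ k ⟧
      evaluate zero _ = trans (cong₂ _+_ (Σℚ-pick {n} {1} (s≤s (s≤s z≤n)) (λ j → x 0 - x j))
        (cong₂ _+_ (Σℚ-0* {n} (λ j → x 0 - x (toℕ j)))
          (cong₂ _+_ (Σℚ-pick {n} {n-1} ℕ.≤-refl (λ j → x 0 - x j)) (Σ-∧ 0 false refl))))
        (trans (solve 3 (λ p q r → p :+ (con 0ℚ :+ (q :+ con 0ℚ :* r)) := p :+ q) refl (x 0 - x 1) (x 0 - x n-1) (x 0 - x 0))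
          laplace-0)
      evaluate (suc i) i<n = trans
        (trans (cong (ΣA′ +_) (cong₂ _+_ prev
            (cong₂ _+_ (Σℚ-0* {n} (λ j → x (suc i) - x (toℕ j))) refl)))
          (trans (solve 3 (λ p q r → p :+ (q :+ (con 0ℚ :+ r)) := (p :+ r) :+ q) refl ΣA′ (x (suc i) - x i) ΣD′)
            (cong (_+ (x (suc i) - x i)) (next (suc i ℕ.≟ n-1)))))
        (laplace-interior i)
        where
        ΣA′ = Σℚ {n} (λ j → ⟦ toℕ j ≡ᵇ suc (suc i) ⟧ * (x (suc i) - x (toℕ j)))
        ΣD′ = Σℚ {n} (λ j → ⟦ (toℕ j ≡ᵇ 0) ∧ (suc i ≡ᵇ n-1) ⟧ * (x (suc i) - x (toℕ j)))
        prev : Σℚ {n} (λ j → ⟦ i ≡ᵇ toℕ j ⟧ * (x (suc i) - x (toℕ j))) ≡ x (suc i) - x i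
        prev = trans (Σℚ-cong {n} (λ j → cong (λ p → ⟦ p ⟧ * (x (suc i) - x (toℕ j))) (≡ᵇ-sym i (toℕ j))))
          (Σℚ-pick {n} {i} (ℕ.<-trans ℕ.≤-refl i<n) (λ j → x (suc i) - x j))
        next : Dec (suc i ≡ n-1) → ΣA′ + ΣD′ ≡ x (suc i) - x (suc (suc i))
        -- At the last vertex the next neighbour is `0`, found by the wrap-around clause, and
        -- `potential-n` lets `x 0` stand for the value at `n`.
        next (yes refl) = trans (cong₂ _+_ (Σℚ-pick-none n (λ j → x (suc i) - x j))
                (Σ-∧ (suc i) (suc i ≡ᵇ n-1) (dec-true (suc i ℕ.≟ n-1) refl)))
              (trans (solve 2 (λ p q → con 0ℚ :+ con 1ℚ :* (p :- q) := p :- q) refl (x (suc i)) (x 0))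
                (cong (λ p → x (suc i) - p) (trans potential-0 (sym potential-n))))
        next (no i≢) = trans (cong₂ _+_ (Σℚ-pick {n} (ℕ.≤∧≢⇒< i<n (λ eq → i≢ (ℕ.suc-injective eq))) (λ j → x (suc i) - x j))
                (Σ-∧ (suc i) (suc i ≡ᵇ n-1) (dec-false (suc i ℕ.≟ n-1) i≢)))
              (solve 2 (λ p q → p :+ con 0ℚ :* q := p) refl (x (suc i) - x (suc (suc i))) (x (suc i) - x 0))

  module _ (G : Graph n) (σ : Fin n ↔ Fin n)
           (iso : ∀ i j → adj G i j ≡ cycleAdj n (Inverse.to σ i) (Inverse.to σ j)) where

    private
      to = Inverse.to σ
      u  = Inverse.from σ zero

    δ-to : ∀ i j → δ (to i) (to j) ≡ δ i j
    δ-to i j with i Fin.≟ j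
    ... | yes refl = cong ⟦_⟧ (dec-true (to i Fin.≟ to i) refl)
    ... | no  i≢j  = cong ⟦_⟧ (dec-false (to i Fin.≟ to j) (λ eq → i≢j (Injection.injective (↔⇒↣ σ) eq)))

    cycle-resistance : ∀ v → IsResistance G u v (cycleRes n-1 (toℕ (to v)))
    cycle-resistance v = X , kirchhoff , (begin
      cycleRes n-1 k                ≡⟨ potential-drop k k≤n-1 ⟨
      potential k 0 - potential k k ≡⟨ cong (λ j → potential k (toℕ j) - potential k k) (Inverse.strictlyInverseˡ σ zero) ⟨
      X u - X v                     ∎)
      where
      open ≡-Reasoning
      k = toℕ (to v)
      k≤n-1 : k ℕ.≤ n-1
      k≤n-1 = ℕ.≤-pred (Fin.toℕ<n (to v))
      X : Fin n → ℚ
      X w = potential k (toℕ (to w))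
      kirchhoff : ∀ i → laplacian G X i ≡ δ i u - δ i v
      kirchhoff i = begin
        Σℚ (λ j → ⟦ adj G i j ⟧ * (X i - X j))
          ≡⟨ Σℚ-cong (λ j → cong (λ b → ⟦ b ⟧ * (X i - X j)) (iso i j)) ⟩
        Σℚ (λ j → ⟦ cycleAdj n (to i) (to j) ⟧ * (X i - potential k (toℕ (to j))))
          ≡⟨ Σℚ-permute (λ j → ⟦ cycleAdj n (to i) j ⟧ * (X i - potential k (toℕ j))) σ ⟨
        Σℚ (λ j → ⟦ cycleAdj n (to i) j ⟧ * (X i - potential k (toℕ j)))
          ≡⟨ cycle-laplacian k k≤n-1 (toℕ (to i)) (Fin.toℕ<n (to i)) ⟩
        ⟦ toℕ (to i) ≡ᵇ 0 ⟧ - ⟦ toℕ (to i) ≡ᵇ k ⟧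
          ≡⟨ cong₂ _-_ (trans (sym (δ≡⟦≡ᵇ⟧ (to i) zero)) (cong (δ (to i)) (sym (Inverse.strictlyInverseˡ σ zero))))
               (sym (δ≡⟦≡ᵇ⟧ (to i) (to v))) ⟩
        δ (to i) (to u) - δ (to i) (to v)
          ≡⟨ cong₂ _-_ (δ-to i u) (δ-to i v) ⟩
        δ i u - δ i v ∎

    cycle-eccentricity : IsResistiveEccentricity G u (bound n)
    cycle-eccentricity = _ , cycle-resistance ,
      trans (sym (Σ-cycleRes n-1)) (Σℚ-permute (λ j → cycleRes n-1 (toℕ j)) σ)

-- The bound and its equality case

break-at : ∀ {A : Set} (xs : List A) {p} → p ℕ.< length xs →
  ∃ λ ys → ∃₂ λ x zs → xs ≡ ys ++ x ∷ zs × length ys ≡ p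
break-at (x ∷ xs) {zero}  _        = [] , x , xs , refl , refl
break-at (y ∷ xs) {suc p} (s≤s p<) with break-at xs p<
... | ys , x , zs , refl , refl = y ∷ ys , x , zs , refl , refl

lookup-++-∷ : ∀ {A : Set} ys {x : A} {zs} {xs} → xs ≡ ys ++ x ∷ zs →
  (i : Fin (length xs)) → toℕ i ≡ length ys → lookup xs i ≡ x
lookup-++-∷ []       refl zero    _  = refl
lookup-++-∷ (_ ∷ ys) refl (suc i) eq = lookup-++-∷ ys refl i (ℕ.suc-injective eq)

lookup-injective : ∀ {A : Set} {xs : List A} → Unique xs → ∀ i j → lookup xs i ≡ lookup xs j → i ≡ j
lookup-injective (_  ∷ _) zero    zero    _  = refl
lookup-injective (px ∷ _) zero    (suc j) eq = ⊥-elim (All.lookup px (∈-lookup j) eq)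
lookup-injective (px ∷ _) (suc i) zero    eq = ⊥-elim (All.lookup px (∈-lookup i) (sym eq))
lookup-injective (_  ∷ !) (suc i) (suc j) eq = cong suc (lookup-injective ! i j eq)

third : ∀ {m} (u t : Fin (suc (suc (suc m)))) → ∃ λ z → z ≢ u × z ≢ t
third zero          zero          = suc zero , (λ ()) , (λ ())
third zero          (suc zero)    = suc (suc zero) , (λ ()) , (λ ())
third zero          (suc (suc _)) = suc zero , (λ ()) , (λ ())
third (suc zero)    zero          = suc (suc zero) , (λ ()) , (λ ())
third (suc (suc _)) zero          = suc zero , (λ ()) , (λ ())
third (suc _)       (suc _)       = zero , (λ ()) , (λ ())

≡does : ∀ {A : Set} {b} (a? : Dec A) → (b ≡ true → A) → (A → b ≡ true) → b ≡ does a?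
≡does {b = true}  (yes _) _ _ = refl
≡does {b = true}  (no ¬a) f _ = ⊥-elim (¬a (f refl))
≡does {b = false} (yes a) _ g = g a
≡does {b = false} (no _)  _ _ = refl

-- Vertices and their positions in the numbering.

module Enumeration {n : ℕ} {M : List (Fin n)} (p : M ↭ allFin n) where

  len : length M ≡ n
  len = trans (↭-length p) (length-tabulate {n = n} (λ i → i))

  ∈M : ∀ v → v ∈ M
  ∈M v = ∈-resp-↭ (↭-sym p) (∈-allFin v)

  at : Fin n → Fin n
  at i = lookup M (cast (sym len) i)

  at-++-∷ : ∀ C {w D} → M ≡ C ++ w ∷ D → ∀ i → toℕ i ≡ length C → at i ≡ w
  at-++-∷ C eq i h = lookup-++-∷ C eq (cast (sym len) i) (trans (Fin.toℕ-cast (sym len) i) h)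

  break : ∀ i → ∃₂ λ C D → M ≡ C ++ at i ∷ D × length C ≡ toℕ i
  break i with break-at M (subst (toℕ i ℕ.<_) (sym len) (Fin.toℕ<n i))
  ... | C , w , D , eq , h = C , D , trans eq (cong (λ w → C ++ w ∷ D) (sym (at-++-∷ C eq i (sym h)))) , h

  rank : Fin n → Fin n
  rank v = cast len (index (∈M v))

  at-rank : ∀ v → at (rank v) ≡ v
  at-rank v = trans (cong (lookup M) (trans (Fin.cast-trans len (sym len) (index (∈M v))) (Fin.cast-is-id refl _)))
    (sym (lookup-index (∈M v)))

  rank-at : ∀ i → rank (at i) ≡ i
  rank-at i = trans (cong (cast len) (lookup-injective (Unique-resp-↭ (↭-sym p) (allFin⁺ n)) _ (cast (sym len) i)
      (sym (lookup-index (∈M (at i))))))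
    (trans (Fin.cast-trans (sym len) len i) (Fin.cast-is-id refl i))

  σ : Fin n ↔ Fin n
  σ = mk↔ₛ′ rank at rank-at at-rank

~⇒≢ : ∀ {n} (G : Graph n) {a b} → adj G a b ≡ true → a ≢ b
~⇒≢ G {a} a~a refl with trans (sym (irrefl G a)) a~a
... | ()

-- Position-wise comparison with the cycle, and rigidity under equality.

module Bound {m : ℕ} (G : Graph (suc (suc (suc m)))) (2conn : TwoConnected G)
             {u t : Fin (suc (suc (suc m)))} (u~t : adj G u t ≡ true) {M : List (Fin (suc (suc (suc m))))}
             (β : Numbering.Bipolar G u t M) (M↭ : M ↭ allFin (suc (suc (suc m)))) where

  open Cycle m using (n; n-1)
  open Numbering G
  open Resistance G
  open Enumeration M↭

  lower-tree : ∀ A {v B} → M ≡ A ++ v ∷ B → Tree u (v ∷ reverse A)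
  lower-tree A {v} {B} eq = tree-suffixʳ B (here refl)
    (subst (Tree u) (trans (cong reverse eq) (++-ʳ++ A)) (proj₂ β))

  upper-tree : ∀ A {v B} → M ≡ A ++ v ∷ B → Tree t (v ∷ B)
  upper-tree A eq = tree-suffix A (here refl) (subst (Tree t) eq (proj₁ β))

  -- For M ≡ A ++ v ∷ B the list B is empty exactly when v ≡ t, so the last field says that vw is not the edge ut.
  record LowerNeighbour (v : Fin n) (A B : List (Fin n)) : Set where
    constructor lowerNeighbour
    field
      C D   : List (Fin n)
      w     : Fin n
      A≡    : A ≡ C ++ w ∷ D
      v~w   : v ~ w
      other : w ≢ u ⊎ (∃ λ b → b ∈ B)

  tree-parent : ∀ {r v a S} → Tree r (v ∷ S) → a ∈ S → ∃ λ w → w ∈ S × v ~ w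
  tree-parent (node w∈ v~w _) _ = _ , w∈ , v~w

  tree-singleton : ∀ {r v} → Tree r [ v ] → v ≡ r
  tree-singleton root = refl

  -- Without `u` the graph still connects `t` to a third vertex; the first step of such a walk is
  -- the required neighbour.
  second-neighbour : ∃ λ w → w ≢ u × t ~ w
  second-neighbour with third u t
  ... | z , z≢u , z≢t with proj₂ (proj₂ 2conn) u t z (λ t≡u → ~⇒≢ G u~t (sym t≡u)) z≢u
  ...   | here _       = ⊥-elim (z≢t refl)
  ...   | step _ t~w ρ = _ , reach-start ρ , t~w

  lower-neighbour : ∀ a A {v} B → M ≡ (a ∷ A) ++ v ∷ B → LowerNeighbour v (a ∷ A) B
  lower-neighbour a A (b ∷ B) eq =
    let w , w∈ , v~w = tree-parent (lower-tree (a ∷ A) eq) (∈-reverse⁺ {xs = a ∷ A} (here refl))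
        C , D , A≡   = ∈-∃++ (∈-resp-↭ (↭-reverse (a ∷ A)) w∈)
    in lowerNeighbour C D w A≡ v~w (inj₂ (b , here refl))
  -- Now `v` is `t`, and its tree parent could be `u`, along the very edge that closes the other
  -- path. Another neighbour of `t` is taken; it precedes `t` because `t` is last.
  lower-neighbour a A {v} [] eq =
    let w , w≢u , t~w = second-neighbour
        v≡t           = tree-singleton (upper-tree (a ∷ A) eq)
        v~w           = subst (_~ w) (sym v≡t) t~w
        C , D , A≡    = ∈-∃++ (w∈A w (~⇒≢ G v~w) (∈-++⁻ (a ∷ A) (subst (w ∈_) eq (∈M w))))
    in lowerNeighbour C D w A≡ v~w (inj₁ w≢u)
    where
    w∈A : ∀ w → v ≢ w → w ∈ a ∷ A ⊎ w ∈ [ v ] → w ∈ a ∷ A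
    w∈A w _   (inj₁ w∈)          = w∈
    w∈A w v≢w (inj₂ (here refl)) = ⊥-elim (v≢w refl)

  module _ {A v B} (eq : M ≡ A ++ v ∷ B) (ν : LowerNeighbour v A B) {r} (res : IsResistance G u v r) where

    open LowerNeighbour ν

    private
      k = fromℕ (suc (length C))
      l = fromℕ (suc (length B))
      d = fromℕ (length D)
      K = fromℕ (length A)
      N = fromℕ n

      reverse-A : reverse A ≡ reverse D ++ w ∷ reverse C
      reverse-A = trans (cong reverse A≡) (trans (++-ʳ++ C) (ʳ++-defn D))

      tree-tail : ∀ {r v a S} → Tree r (v ∷ S) → a ∈ S → Tree r S
      tree-tail (node _ _ τ) _ = τ

      split-permutation : v ∷ (reverse D ++ w ∷ reverse C) ++ B ↭ allFin n
      split-permutation = ↭-trans (↭-prep v (++⁺ʳ B (subst (_↭ A) reverse-A (↭-reverse A))))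
        (↭-trans (↭-sym (shift v A B)) (subst (_↭ allFin n) eq M↭))

      parallel : (k + l) * r ≤ k * l
      parallel = subst (λ c → (fromℕ (suc c) + l) * r ≤ fromℕ (suc c) * l) (length-reverse C)
        (resistance-≤ (reverse D) (reverse C) B u~t v~w
          (subst (Tree u) reverse-A (tree-tail (lower-tree A eq)
            (∈-reverse⁺ {xs = A} (subst (w ∈_) (sym A≡) (∈-insert C)))))
          (upper-tree A eq) split-permutation other res)

      K≡ : K ≡ d + k
      K≡ = trans (cong fromℕ (trans (cong length A≡) (trans (length-++ C)
        (trans (ℕ.+-suc (length C) (length D)) (ℕ.+-comm (suc (length C)) (length D))))))
        (fromℕ-+ (length D) (suc (length C)))

      N≡ : N ≡ d + k + l
      N≡ = trans (cong fromℕ (trans (sym len) (trans (cong length eq) (length-++ A))))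
        (trans (fromℕ-+ (length A) (suc (length B))) (cong (_+ l) K≡))

      N*cycleRes : N * cycleRes n-1 (length A) ≡ (d + k) * l
      N*cycleRes = trans (n*cycleRes n-1 (length A)) (trans (cong₂ (λ K N → K * (N - K)) K≡ N≡)
        (solve 2 (λ K l → K :* (K :+ l :- K) := K :* l) refl (d + k) l))

    -- The paths have at most `k` and `l` edges, while `d` counts the vertices skipped between `w`
    -- and `v`. As `K` is `d + k` and `N` is `d + k + l`, weakening `k` to `d + k` gives exactly K(N
    -- - K)/N.
    lower-neighbour-≤ : r ≤ cycleRes n-1 (length A)
    lower-neighbour-≤ = *-cancel-≤ˡ (0<fromℕ n-1) (subst₂ _≤_ (cong (_* r) (sym N≡)) (sym N*cycleRes)
      (parallel-weaken-≤ (0≤fromℕ (suc (length C))) (0<fromℕ (length B)) parallel (0≤fromℕ (length D))))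

    lower-neighbour-< : D ≢ [] → r < cycleRes n-1 (length A)
    lower-neighbour-< D≢[] = *-cancel-<ˡ (0≤fromℕ n) (subst₂ _<_ (cong (_* r) (sym N≡)) (sym N*cycleRes)
      (parallel-weaken-< (0≤fromℕ (suc (length C))) (0<fromℕ (length B)) parallel (0<d D D≢[])))
      where
      0<d : ∀ D → D ≢ [] → 0ℚ < fromℕ (length D)
      0<d []      D≢[] = ⊥-elim (D≢[] refl)
      0<d (_ ∷ D) _    = 0<fromℕ (length D)

  resistance-≤-cycleRes : ∀ A {v B r} → M ≡ A ++ v ∷ B → IsResistance G u v r → r ≤ cycleRes n-1 (length A)
  resistance-≤-cycleRes (a ∷ A) {B = B} eq res = lower-neighbour-≤ eq (lower-neighbour a A B eq) res
  resistance-≤-cycleRes [] eq (x , _ , refl) with tree-singleton (lower-tree [] eq)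
  ... | refl = ≤-reflexive (trans (+-inverseʳ (x u))
    (solve 2 (λ N r → con 0ℚ := con 0ℚ :* (N :- con 0ℚ) :* r) refl (fromℕ n) (recip n-1)))

  module _ {r : Fin n → ℚ} (res : ∀ v → IsResistance G u v (r v)) where

    at-≤ : ∀ i → r (at i) ≤ cycleRes n-1 (toℕ i)
    at-≤ i with break i
    ... | A , B , eq , h = subst (λ k → r (at i) ≤ cycleRes n-1 k) h (resistance-≤-cycleRes A eq (res (at i)))

    Σr≡ : Σℚ r ≡ Σℚ (λ i → r (at i))
    Σr≡ = Σℚ-permute r (↔-sym σ)

    eccentricity-≤ : Σℚ r ≤ bound n
    eccentricity-≤ = subst₂ _≤_ (sym Σr≡) (Σ-cycleRes n-1) (Σℚ-mono-≤ at-≤)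

    module _ (tight : bound n ≡ Σℚ r) where

      -- All position-wise bounds hold and both sides have the same total, so none is strict; a
      -- skipped vertex would make the one at `i` strict.
      predecessor : ∀ {A B} i → M ≡ A ++ at i ∷ B → length A ≡ toℕ i →
        (ν : LowerNeighbour (at i) A B) → LowerNeighbour.D ν ≡ []
      predecessor {A} i eq h ν with LowerNeighbour.D ν in D≡
      ... | []    = refl
      ... | _ ∷ _ = ⊥-elim (<-irrefl (trans (sym Σr≡) (trans (sym tight) (sym (Σ-cycleRes n-1))))
        (Σℚ-mono-< i at-≤ (subst (λ k → r (at i) < cycleRes n-1 k) h
          (lower-neighbour-< eq ν (res (at i)) (λ D≡[] → case trans (sym D≡) D≡[] of λ ())))))

      at-zero : at zero ≡ u
      at-zero with break zero
      ... | [] , B , eq , _ = tree-singleton (lower-tree [] eq)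

      at-last : ∀ i → toℕ i ≡ n-1 → at i ≡ t
      at-last i i≡ with break i
      ... | A , [] , eq , _ = tree-singleton (upper-tree A eq)
      ... | A , b ∷ B , eq , h = ⊥-elim (ℕ.m+1+n≢m n-1 (ℕ.suc-injective (begin
        suc (n-1 ℕ.+ suc (length B))     ≡⟨ ℕ.+-suc n-1 (suc (length B)) ⟨
        n-1 ℕ.+ suc (suc (length B))     ≡⟨ cong (ℕ._+ suc (suc (length B))) (trans h i≡) ⟨
        length A ℕ.+ suc (suc (length B)) ≡⟨ length-++ A ⟨
        length (A ++ at i ∷ b ∷ B)       ≡⟨ cong length eq ⟨
        length M                         ≡⟨ len ⟩
        suc n-1                          ∎)))
        where open ≡-Reasoning

      at-injective : ∀ {i j} → at i ≡ at j → i ≡ j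
      at-injective {i} {j} eq = trans (sym (rank-at i)) (trans (cong rank eq) (rank-at j))

      -- A lower neighbour of `at j` always exists, and under equality it can only be the vertex
      -- immediately before it.
      consecutive : ∀ i j → toℕ j ≡ suc (toℕ i) → at i ~ at j
      consecutive i j j≡ with break j
      ... | [] , _ , _ , h = case trans h j≡ of λ ()
      ... | a ∷ A , B , eq , h = subst (_~ at j) (sym (at-++-∷ C M≡ i (ℕ.suc-injective (begin
            suc (toℕ i)        ≡⟨ j≡ ⟨
            toℕ j              ≡⟨ h ⟨
            length (a ∷ A)     ≡⟨ cong length A≡C∷ʳw ⟩
            length (C ++ [ w ]) ≡⟨ length-++ C ⟩
            length C ℕ.+ 1     ≡⟨ ℕ.+-comm (length C) 1 ⟩
            suc (length C)     ∎)))) (~-sym v~w)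
        where
        open ≡-Reasoning
        ν = lower-neighbour a A B eq
        open LowerNeighbour ν
        A≡C∷ʳw : a ∷ A ≡ C ++ [ w ]
        A≡C∷ʳw = trans A≡ (cong (λ D → C ++ w ∷ D) (predecessor j eq h ν))
        M≡ : M ≡ C ++ w ∷ at j ∷ B
        M≡ = trans eq (trans (cong (_++ at j ∷ B) A≡C∷ʳw) (++-assoc C [ w ] (at j ∷ B)))

      -- Unless the edge is `ut`, its earlier end qualifies as a lower neighbour of the later one,
      -- so `predecessor` makes them adjacent in the numbering. The exception needs `at j` to be
      -- last and `at i` to be `u`, which is the wrap-around edge.
      edge-forward : ∀ i j → toℕ i ℕ.< toℕ j → at i ~ at j →
        toℕ j ≡ suc (toℕ i) ⊎ (toℕ i ≡ 0 × toℕ j ≡ n-1)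
      edge-forward i j i<j i~j with break j
      ... | A , B , eq , h with break-at A (subst (toℕ i ℕ.<_) (sym h) i<j)
      ...   | C , w , D , A≡ , hC = cases B eq
        where
        open ≡-Reasoning
        at-i≡w : ∀ {B} → M ≡ A ++ at j ∷ B → at i ≡ w
        at-i≡w {B} eq = at-++-∷ C (trans eq (trans (cong (_++ at j ∷ B) A≡) (++-assoc C (w ∷ D) (at j ∷ B)))) i (sym hC)
        adjacent : ∀ B → M ≡ A ++ at j ∷ B → w ≢ u ⊎ (∃ λ b → b ∈ B) → toℕ j ≡ suc (toℕ i)
        adjacent B eq other = begin
          toℕ j               ≡⟨ h ⟨
          length A            ≡⟨ cong length A≡ ⟩
          length (C ++ w ∷ D) ≡⟨ cong (λ D → length (C ++ w ∷ D))
                                   (predecessor j eq h (lowerNeighbour C D w A≡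
                                     (subst (at j ~_) (at-i≡w eq) (~-sym i~j)) other)) ⟩
          length (C ++ [ w ]) ≡⟨ length-++ C ⟩
          length C ℕ.+ 1      ≡⟨ ℕ.+-comm (length C) 1 ⟩
          suc (length C)      ≡⟨ cong suc hC ⟩
          suc (toℕ i)         ∎
        cases : ∀ B → M ≡ A ++ at j ∷ B → toℕ j ≡ suc (toℕ i) ⊎ (toℕ i ≡ 0 × toℕ j ≡ n-1)
        cases (b ∷ B) eq = inj₁ (adjacent (b ∷ B) eq (inj₂ (b , here refl)))
        cases [] eq with w Fin.≟ u
        ... | no w≢u  = inj₁ (adjacent [] eq (inj₁ w≢u))
        ... | yes w≡u = inj₂ (cong toℕ (at-injective {i} {zero} (trans (at-i≡w eq) (trans w≡u (sym at-zero)))) ,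
          ℕ.suc-injective (begin
            suc (toℕ j)            ≡⟨ cong suc h ⟨
            suc (length A)         ≡⟨ ℕ.+-comm 1 (length A) ⟩
            length A ℕ.+ 1         ≡⟨ length-++ A ⟨
            length (A ++ [ at j ]) ≡⟨ cong length eq ⟨
            length M               ≡⟨ len ⟩
            suc n-1                ∎))

      CycleEdge : Fin n → Fin n → Set
      CycleEdge i j = toℕ j ≡ suc (toℕ i) ⊎ (toℕ i ≡ suc (toℕ j) ⊎
        (toℕ i ≡ 0 × toℕ j ≡ n-1 ⊎ toℕ j ≡ 0 × toℕ i ≡ n-1))

      cycleEdge? : ∀ i j → Dec (CycleEdge i j)
      cycleEdge? i j = (toℕ j ℕ.≟ suc (toℕ i)) ⊎-dec ((toℕ i ℕ.≟ suc (toℕ j)) ⊎-dec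
        (((toℕ i ℕ.≟ 0) ×-dec (toℕ j ℕ.≟ n-1)) ⊎-dec ((toℕ j ℕ.≟ 0) ×-dec (toℕ i ℕ.≟ n-1))))

      edge⇒cycleEdge : ∀ i j → at i ~ at j → CycleEdge i j
      edge⇒cycleEdge i j i~j with ℕ.<-cmp (toℕ i) (toℕ j)
      ... | tri≈ _ i≡j _ = ⊥-elim (~⇒≢ G i~j (cong at (Fin.toℕ-injective i≡j)))
      ... | tri< i<j _ _ with edge-forward i j i<j i~j
      ...   | inj₁ s = inj₁ s
      ...   | inj₂ e = inj₂ (inj₂ (inj₁ e))
      edge⇒cycleEdge i j i~j | tri> _ _ j<i with edge-forward j i j<i (~-sym i~j)
      ...   | inj₁ s = inj₂ (inj₁ s)
      ...   | inj₂ e = inj₂ (inj₂ (inj₂ e))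

      wrap : ∀ i j → toℕ i ≡ 0 → toℕ j ≡ n-1 → at i ~ at j
      wrap zero j _ j≡ = subst₂ _~_ (sym at-zero) (sym (at-last j j≡)) u~t

      cycleEdge⇒edge : ∀ i j → CycleEdge i j → at i ~ at j
      cycleEdge⇒edge i j (inj₁ s)                      = consecutive i j s
      cycleEdge⇒edge i j (inj₂ (inj₁ s))               = ~-sym (consecutive j i s)
      cycleEdge⇒edge i j (inj₂ (inj₂ (inj₁ (p , q)))) = wrap i j p q
      cycleEdge⇒edge i j (inj₂ (inj₂ (inj₂ (p , q)))) = ~-sym (wrap j i p q)

      isoToCycle : IsoToCycle G
      isoToCycle = σ , λ a b → ≡does (cycleEdge? (rank a) (rank b))
        (λ a~b → edge⇒cycleEdge (rank a) (rank b) (subst₂ _~_ (sym (at-rank a)) (sym (at-rank b)) a~b))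
        (λ e → subst₂ _~_ (at-rank a) (at-rank b) (cycleEdge⇒edge (rank a) (rank b) e))

st-numbering : ∀ {m} (G : Graph (suc (suc (suc m)))) → TwoConnected G → ∀ u →
  ∃ λ t → adj G u t ≡ true × ∃ λ M → Numbering.Bipolar G u t M × M ↭ allFin _
st-numbering G (conn , _ , 2conn) u with third u u
... | z , z≢u , _ with conn u z
...   | here _       = ⊥-elim (z≢u refl)
...   | step _ u~t _ = _ , u~t , Numbering.bipolar-exists G conn 2conn (~⇒≢ G u~t) u~t

theorem2p6 : (n : ℕ) (G : Graph n) → TwoConnected G →
    ((u : Fin n) (e : ℚ) → IsResistiveEccentricity G u e → e ≤ bound n)
    × ((∃ λ (u : Fin n) → IsResistiveEccentricity G u (bound n)) ⇔ IsoToCycle G)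
theorem2p6 (suc (suc (suc m))) G 2conn =
  (λ { u _ (r , res , refl) →
    let _ , u~t , _ , β , p = st-numbering G 2conn u in Bound.eccentricity-≤ G 2conn u~t β p res }) ,
  mk⇔
    (λ (u , r , res , tight) →
      let _ , u~t , _ , β , p = st-numbering G 2conn u in Bound.isoToCycle G 2conn u~t β p res tight)
    (λ (σ , iso) → Inverse.from σ zero , Cycle.cycle-eccentricity m G σ iso)
theorem2p6 (suc zero)       G (_ , s≤s () , _)
theorem2p6 (suc (suc zero)) G (_ , s≤s (s≤s ()) , _)
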